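{- Let $P\in\{\mathrm{BTI},\mathrm{BTX}\}$. There is a polynomial-time algorithm which, given a binary CSP instance $I$ with a fixed total variable order, finds a total domain ordering such that $P$ does not occur in $I$ (equipped with these orders), or determines that no such domain ordering exists.
   Context: A pattern is a tuple $\langle X,D,A,\mathrm{cpt},<_X,<_D\rangle$ where $X$ is a finite set of variables; $D$ is a finite set of values; $A\subseteq X\times D$ is the set of points, with $D(x)=\{a\in D\mid \langle x,a\rangle\in A\}$ non-empty for every $x\in X$; $\mathrm{cpt}$ is a partial function from the set of unordered pairs of points $\{\langle x,a\rangle,\langle y,b\rangle\}$ with $x\neq y$ to $\{\mathrm{TRUE},\mathrm{FALSE}\}$; $<_X$ and $<_D$ are (possibly partial) strict orders on $X$ and $D$. Pairs of points with $\mathrm{cpt}=\mathrm{TRUE}$ (FALSE) are positive (negative) edges. A binary CSP instance is a tuple $\langle X,D,A,\mathrm{cpt}\rangle$ (no orders) where $X$ is a finite set of variables; $D$ is a finite set of values; $A\subseteq X\times D$ is the set of points, with $D(x)=\{a\in D\mid \langle x,a\rangle\in A\}$ non-empty for every $x\in X$; and $\mathrm{cpt}$ is a function to $\{\mathrm{TRUE},\mathrm{FALSE}\}$ that is total on all unordered pairs of points belonging to distinct variables; it is given explicitly as input, and its domain $D$ is part of the input. A total domain ordering is a total order on $D$. A homomorphism from $P'=\langle X',D',A',\mathrm{cpt}',<_{X'},<_{D'}\rangle$ to $P=\langle X,D,A,\mathrm{cpt},<_X,<_D\rangle$ is a (not necessarily injective) map $f:A'\to A$ such that: if $\mathrm{cpt}'(p,q)$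 is defined then $\mathrm{cpt}(f(p),f(q))=\mathrm{cpt}'(p,q)$; the map $f_{var}:X'\to X$ given by $f_{var}(x')=x$ if $f(\langle x',a'\rangle)=\langle x,a\rangle$ for some $a',a$ is well-defined and injective; $x'<_{X'}y'$ implies $f_{var}(x')<_X f_{var}(y')$; and if $a',b'\in D'(x')$, $a'<_{D'}b'$, $f(\langle x',a'\rangle)=\langle x,a\rangle$, $f(\langle x',b'\rangle)=\langle x,b\rangle$, then $a<_D b$. For given total orders on the variables $X$ and on the values $D$ of $I$, a pattern occurs in $I$ if there is a homomorphism from it to $I$ equipped with these orders. $\mathrm{BTX}$ and $\mathrm{BTI}$ have the same points and edges: variables $x,y,z$ with pairwise disjoint domains $D(x)=\{\epsilon\}$, $D(y)=\{\alpha,\beta\}$, $D(z)=\{\gamma,\delta\}$ (each value stands for its point); negative edges $\alpha\gamma$, $\epsilon\delta$; positive edges $\alpha\delta$, $\beta\gamma$, $\alpha\epsilon$, $\epsilon\gamma$; no other pair has defined compatibility. Orders: for $\mathrm{BTX}$: $y<x$, $y<z$, $\alpha>\beta$; for $\mathrm{BTI}$: $x<z$, $\alpha>\beta$. -}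

module Defs where

open import Data.Bool.Base using (Bool; true; false)
open import Data.Bool.Properties using () renaming (_≟_ to _≟ᵇ_)
open import Data.Fin.Base using (Fin; zero; suc)
open import Data.Fin.Properties using (all?) renaming (_≟_ to _≟ᶠ_)
open import Data.Fin.Subset using (Subset; Nonempty; _∈_; ⁅_⁆; _∪_)
open import Data.Fin.Subset.Properties using (_∈?_)
open import Data.List.Base using (List; []; _∷_; tabulate)
open import Data.Maybe using (Maybe; just; nothing; Is-just)
open import Data.Maybe.Properties using (≡-dec)
open import Data.Maybe.Relation.Unary.Any using (dec)
open import Data.Nat.Base using (ℕ; zero; suc; _+_; _*_; _^_; _≤_)
open import Data.Product.Base using (Σ-syntax; ∃-syntax; _×_; _,_; proj₁)
open import Data.Unit.Base using (tt)
open import Data.Vec.Base using (Vec; []; _∷_; lookup)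
open import Function.Definitions using (Injective)
open import Level using (Level; 0ℓ; Lift)
open import Relation.Binary.Core using (Rel)
open import Relation.Binary.PropositionalEquality
  using (_≡_; _≢_; refl; isEquivalence; resp₂)
open import Relation.Binary.Structures using (IsStrictPartialOrder; IsStrictTotalOrder)
open import Relation.Nullary.Decidable
  using (does; yes; from-yes; _→-dec_; _×-dec_; ¬?)
open import Relation.Nullary.Negation using (¬_)

------------------------------------------------------------------------
-- Patterns, instances, homomorphisms

-- The data ⟨X, D, A, cpt⟩ common to patterns and instances, with
-- X = Fin #X and D = Fin #D.  The partial function cpt is given on all
-- pairs of elements of X × D, with value `nothing` where it is undefined;
-- cpt-sym makes it a function of unordered pairs, and cpt-domain confines
-- its domain to pairs of points with distinct variables.
record Structure : Set where
  field
    #X #D : ℕ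
    dom   : Fin #X → Subset #D

  _∈A : Fin #X × Fin #D → Set
  (x , a) ∈A = a ∈ dom x

  field
    dom-nonempty : ∀ x → Nonempty (dom x)
    cpt          : (p q : Fin #X × Fin #D) → Maybe Bool
    cpt-sym      : ∀ p q → cpt p q ≡ cpt q p
    cpt-domain   : ∀ p q → Is-just (cpt p q) →
                   p ∈A × q ∈A × proj₁ p ≢ proj₁ q

  Point : Set
  Point = Σ[ p ∈ Fin #X × Fin #D ] p ∈A

  var : Point → Fin #X
  var ((x , _) , _) = x

  val : Point → Fin #D
  val ((_ , a) , _) = a

  compat : Point → Point → Maybe Bool
  compat p q = cpt (proj₁ p) (proj₁ q)

record Pattern : Set₁ where
  field
    structure : Structure
  open Structure structure public
  field
    _<X_  : Rel (Fin #X) 0ℓ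
    _<D_  : Rel (Fin #D) 0ℓ
    <X-isStrictPartialOrder : IsStrictPartialOrder _≡_ _<X_
    <D-isStrictPartialOrder : IsStrictPartialOrder _≡_ _<D_

record Homomorphism (P′ P : Pattern) : Set where
  private
    module P′ = Pattern P′
    module P  = Pattern P
  field
    f              : P′.Point → P.Point
    preserves-cpt  : ∀ p q t → P′.compat p q ≡ just t → P.compat (f p) (f q) ≡ just t
    -- The existence of f-var is the well-definedness requirement; since
    -- all domains of P′ are non-empty, f determines it.
    f-var          : Fin P′.#X → Fin P.#X
    f-var-def      : ∀ p → P.var (f p) ≡ f-var (P′.var p)
    f-var-inj      : Injective _≡_ _≡_ f-var
    preserves-<X   : ∀ x y → x P′.<X y → f-var x P.<X f-var y
    preserves-<D   : ∀ p q → P′.var p ≡ P′.var q → P′.val p P′.<D P′.val q →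
                     P.val (f p) P.<D P.val (f q)

record TotalOrder (n : ℕ) : Set₁ where
  field
    _≺_                : Rel (Fin n) 0ℓ
    isStrictTotalOrder : IsStrictTotalOrder _≡_ _≺_
  open IsStrictTotalOrder isStrictTotalOrder public

record Instance : Set where
  field
    structure : Structure
  open Structure structure public
  field
    cpt-total : ∀ p q → p ∈A → q ∈A → proj₁ p ≢ proj₁ q → Is-just (cpt p q)

withOrders : (I : Instance) → TotalOrder (Instance.#X I) → TotalOrder (Instance.#D I) → Pattern
withOrders I X< D< = record
  { structure = Instance.structure I
  ; _<X_ = TotalOrder._≺_ X<
  ; _<D_ = TotalOrder._≺_ D<
  ; <X-isStrictPartialOrder = TotalOrder.isStrictPartialOrder X<
  ; <D-isStrictPartialOrder = TotalOrder.isStrictPartialOrder D<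
  }

Occurs : (P : Pattern) (I : Instance) →
         TotalOrder (Instance.#X I) → TotalOrder (Instance.#D I) → Set
Occurs P I X< D< = Homomorphism P (withOrders I X< D<)

------------------------------------------------------------------------
-- The patterns BTX and BTI

module BT where

  pattern x = zero
  pattern y = suc zero
  pattern z = suc (suc zero)

  pattern α = zero
  pattern β = suc zero
  pattern γ = suc (suc zero)
  pattern δ = suc (suc (suc zero))
  pattern ε = suc (suc (suc (suc zero)))

  dom : Fin 3 → Subset 5
  dom x = ⁅ ε ⁆
  dom y = ⁅ α ⁆ ∪ ⁅ β ⁆
  dom z = ⁅ γ ⁆ ∪ ⁅ δ ⁆

  cpt : (p q : Fin 3 × Fin 5) → Maybe Bool
  cpt (y , α) (z , γ) = just false
  cpt (z , γ) (y , α) = just false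
  cpt (x , ε) (z , δ) = just false
  cpt (z , δ) (x , ε) = just false
  cpt (y , α) (z , δ) = just true
  cpt (z , δ) (y , α) = just true
  cpt (y , β) (z , γ) = just true
  cpt (z , γ) (y , β) = just true
  cpt (y , α) (x , ε) = just true
  cpt (x , ε) (y , α) = just true
  cpt (x , ε) (z , γ) = just true
  cpt (z , γ) (x , ε) = just true
  cpt _ _ = nothing

  structure : Structure
  structure = record
    { #X = 3
    ; #D = 5
    ; dom = dom
    ; dom-nonempty = λ where
        x → ε , from-yes (ε ∈? dom x)
        y → α , from-yes (α ∈? dom y)
        z → γ , from-yes (γ ∈? dom z)
    ; cpt = cpt
    ; cpt-sym = λ (v , a) (w , b) → sym-table v a w b
    ; cpt-domain = λ (v , a) (w , b) → domain-table v a w b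
    }
    where
    sym-table : ∀ v a w b → cpt (v , a) (w , b) ≡ cpt (w , b) (v , a)
    sym-table = from-yes (all? λ v → all? λ a → all? λ w → all? λ b →
      ≡-dec _≟ᵇ_ (cpt (v , a) (w , b)) (cpt (w , b) (v , a)))

    domain-table : ∀ v a w b → Is-just (cpt (v , a) (w , b)) →
                   a ∈ dom v × b ∈ dom w × v ≢ w
    domain-table = from-yes (all? λ v → all? λ a → all? λ w → all? λ b →
      dec (λ _ → yes tt) (cpt (v , a) (w , b)) →-dec
      ((a ∈? dom v) ×-dec ((b ∈? dom w) ×-dec ¬? (v ≟ᶠ w))))

  data _<D_ : Rel (Fin 5) 0ℓ where
    β<α : β <D α

  data _<BTX_ : Rel (Fin 3) 0ℓ where
    y<x : y <BTX x
    y<z : y <BTX z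

  data _<BTI_ : Rel (Fin 3) 0ℓ where
    x<z : x <BTI z

  <D-isStrictPartialOrder : IsStrictPartialOrder _≡_ _<D_
  <D-isStrictPartialOrder = record
    { isEquivalence = isEquivalence
    ; irrefl = λ { refl () }
    ; trans = λ { β<α () }
    ; <-resp-≈ = resp₂ _<D_
    }

  <BTX-isStrictPartialOrder : IsStrictPartialOrder _≡_ _<BTX_
  <BTX-isStrictPartialOrder = record
    { isEquivalence = isEquivalence
    ; irrefl = λ { refl () }
    ; trans = λ { y<x () ; y<z () }
    ; <-resp-≈ = resp₂ _<BTX_
    }

  <BTI-isStrictPartialOrder : IsStrictPartialOrder _≡_ _<BTI_
  <BTI-isStrictPartialOrder = record
    { isEquivalence = isEquivalence
    ; irrefl = λ { refl () }
    ; trans = λ { x<z () }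
    ; <-resp-≈ = resp₂ _<BTI_
    }

BTX : Pattern
BTX = record
  { structure = BT.structure
  ; _<X_ = BT._<BTX_
  ; _<D_ = BT._<D_
  ; <X-isStrictPartialOrder = BT.<BTX-isStrictPartialOrder
  ; <D-isStrictPartialOrder = BT.<D-isStrictPartialOrder
  }

BTI : Pattern
BTI = record
  { structure = BT.structure
  ; _<X_ = BT._<BTI_
  ; _<D_ = BT._<D_
  ; <X-isStrictPartialOrder = BT.<BTI-isStrictPartialOrder
  ; <D-isStrictPartialOrder = BT.<D-isStrictPartialOrder
  }

------------------------------------------------------------------------
-- Model of computation: a first-order, call-by-value functional language
-- (with general recursion) on binary trees.  Every evaluation step costs
-- one unit, as on a pointer machine where `cons` allocates one cell and
-- values are passed by reference.  For results whose size is polynomial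
-- in that of the input, polynomial time here agrees with polynomial time
-- on Turing machines: a run of t steps creates at most t cells.

infixr 5 _∙_

data Tree : Set where
  nil : Tree
  _∙_ : Tree → Tree → Tree

size : Tree → ℕ
size nil     = 1
size (s ∙ t) = suc (size s + size t)

-- Expressions with n variables in scope (de Bruijn indices), calling m
-- functions with the given arities.
data Exp {m : ℕ} (arity : Fin m → ℕ) (n : ℕ) : Set where
  var  : Fin n → Exp arity n
  nil  : Exp arity n
  cons : Exp arity n → Exp arity n → Exp arity n
  -- case e of { nil → e₁ ; h ∙ t → e₂ }, where in e₂ the variables 0 and
  -- 1 are h and t.
  case : Exp arity n → Exp arity n → Exp arity (suc (suc n)) → Exp arity n
  bind : Exp arity n → Exp arity (suc n) → Exp arity n
  call : (f : Fin m) → Vec (Exp arity n) (arity f) → Exp arity n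

record Program : Set where
  field
    #functions : ℕ
    arity      : Fin #functions → ℕ
    body       : (f : Fin #functions) → Exp arity (arity f)
    main       : Exp arity 1

module Semantics (P : Program) where
  open Program P

  mutual

    -- In environment ρ the expression e evaluates to v in t steps.
    data _⊢_⇓_⟨_⟩ {n} (ρ : Vec Tree n) : Exp arity n → Tree → ℕ → Set where
      ⇓var  : ∀ {i} → ρ ⊢ var i ⇓ lookup ρ i ⟨ 1 ⟩
      ⇓nil  : ρ ⊢ nil ⇓ nil ⟨ 1 ⟩
      ⇓cons : ∀ {e₁ e₂ v₁ v₂ t₁ t₂} →
              ρ ⊢ e₁ ⇓ v₁ ⟨ t₁ ⟩ → ρ ⊢ e₂ ⇓ v₂ ⟨ t₂ ⟩ →
              ρ ⊢ cons e₁ e₂ ⇓ v₁ ∙ v₂ ⟨ suc (t₁ + t₂) ⟩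
      ⇓case-nil : ∀ {e e₁ e₂ v t t₁} →
              ρ ⊢ e ⇓ nil ⟨ t ⟩ → ρ ⊢ e₁ ⇓ v ⟨ t₁ ⟩ →
              ρ ⊢ case e e₁ e₂ ⇓ v ⟨ suc (t + t₁) ⟩
      ⇓case-∙ : ∀ {e e₁ e₂ h l v t t₂} →
              ρ ⊢ e ⇓ h ∙ l ⟨ t ⟩ → (h ∷ l ∷ ρ) ⊢ e₂ ⇓ v ⟨ t₂ ⟩ →
              ρ ⊢ case e e₁ e₂ ⇓ v ⟨ suc (t + t₂) ⟩
      ⇓bind : ∀ {e₁ e₂ u v t₁ t₂} →
              ρ ⊢ e₁ ⇓ u ⟨ t₁ ⟩ → (u ∷ ρ) ⊢ e₂ ⇓ v ⟨ t₂ ⟩ →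
              ρ ⊢ bind e₁ e₂ ⇓ v ⟨ suc (t₁ + t₂) ⟩
      ⇓call : ∀ {f es us v t₁ t₂} →
              ρ ⊢* es ⇓ us ⟨ t₁ ⟩ → us ⊢ body f ⇓ v ⟨ t₂ ⟩ →
              ρ ⊢ call f es ⇓ v ⟨ suc (t₁ + t₂) ⟩

    data _⊢*_⇓_⟨_⟩ {n} (ρ : Vec Tree n) :
                   ∀ {k} → Vec (Exp arity n) k → Vec Tree k → ℕ → Set where
      ⇓[] : ρ ⊢* [] ⇓ [] ⟨ 0 ⟩
      ⇓∷  : ∀ {k e v t t′} {es : Vec (Exp arity n) k} {vs} →
            ρ ⊢ e ⇓ v ⟨ t ⟩ → ρ ⊢* es ⇓ vs ⟨ t′ ⟩ →
            ρ ⊢* (e ∷ es) ⇓ (v ∷ vs) ⟨ t + t′ ⟩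

Runs : Program → Tree → Tree → ℕ → Set
Runs P input output t = (input ∷ []) ⊢ main ⇓ output ⟨ t ⟩
  where
  open Program P
  open Semantics P

-- The search problem "given i, find a correct o" is solved by one program
-- in polynomial time.  The program and the bound do not depend on i.
PolyTimeSolvable : (Input : Set₁) (Output : Input → Set₁)
                   (codeIn : Input → Tree) (codeOut : ∀ i → Output i → Tree)
                   (Correct : ∀ i → Output i → Set₁) → Set₁
PolyTimeSolvable Input Output codeIn codeOut Correct =
  Σ[ P ∈ Program ] ∃[ c ] ∃[ k ] (∀ i →
    Σ[ o ∈ Output i ] Σ[ t ∈ ℕ ]
      Correct i o ×
      Runs P (codeIn i) (codeOut i o) t ×
      t ≤ c * size (codeIn i) ^ k)

------------------------------------------------------------------------
-- Representation of instances and orders as trees (explicit tables)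

codeList : List Tree → Tree
codeList []       = nil
codeList (t ∷ ts) = t ∙ codeList ts

codeTable : ∀ {n} → (Fin n → Tree) → Tree
codeTable g = codeList (tabulate g)

-- Unary.
codeℕ : ℕ → Tree
codeℕ zero    = nil
codeℕ (suc n) = nil ∙ codeℕ n

codeBool : Bool → Tree
codeBool false = nil
codeBool true  = nil ∙ nil

codeMaybe : {ℓ : Level} {A : Set ℓ} → (A → Tree) → Maybe A → Tree
codeMaybe code nothing  = nil
codeMaybe code (just a) = nil ∙ code a

codeOrder : ∀ {n} → TotalOrder n → Tree
codeOrder {n} O = codeTable λ i → codeTable λ j → codeBool (does (i <? j))
  where open TotalOrder O

codeInstance : Instance → Tree
codeInstance I = codeList
  ( codeℕ #X
  ∷ codeℕ #D
  ∷ codeTable (λ x → codeTable λ a → codeBool (lookup (dom x) a))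
  ∷ codeTable (λ x → codeTable λ a → codeTable λ y → codeTable λ b →
      codeMaybe codeBool (cpt (x , a) (y , b)))
  ∷ [])
  where open Instance I

------------------------------------------------------------------------
-- The problem of finding a domain ordering that avoids P

OrderedInstance : Set₁
OrderedInstance = Σ[ I ∈ Instance ] TotalOrder (Instance.#X I)

codeOrderedInstance : OrderedInstance → Tree
codeOrderedInstance (I , X<) = codeInstance I ∙ codeOrder X<

-- `nothing` is the answer "no such domain ordering exists".
DomainOrdering : OrderedInstance → Set₁
DomainOrdering (I , _) = Maybe (TotalOrder (Instance.#D I))

codeDomainOrdering : ∀ i → DomainOrdering i → Tree
codeDomainOrdering _ = codeMaybe codeOrder

Avoids : (P : Pattern) (i : OrderedInstance) → DomainOrdering i → Set₁
Avoids P (I , X<) (just D<) = Lift _ (¬ Occurs P I X< D<)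
Avoids P (I , X<) nothing   = ¬ (Σ[ D< ∈ TotalOrder (Instance.#D I) ] ¬ Occurs P I X< D<)

{-# OPTIONS --safe #-}

-- The value order occurs in BTI and BTX only in the condition β < α, so each way
-- of mapping the unordered pattern into the instance in accordance with the
-- variable order forces the image of α before that of β; an ordering of D avoids
-- the pattern exactly when it satisfies all these constraints.  Starting from the
-- identity, add the forced pairs one by one, closing transitively and skipping a
-- pair whose reverse already holds.  Every partial order reached is contained in
-- each ordering that satisfies the constraints, so a forced pair is skipped only if
-- there is none.  Adding all pairs in the same way then makes the order total.
--
-- The algorithm is a term of a small language with loops over subtrees of the
-- input, whose terms all run in polynomial time, and the program is an interpreter
-- for this language applied to the code of the term.

module Submission where

open import Algebra.Properties.CommutativeSemigroup using (x∙yz≈y∙xz)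
open import Data.Bool.Base using (Bool; true; false; not; _∧_; _∨_; if_then_else_; T)
open import Data.Bool.ListAction using (all)
open import Data.Bool.Properties using (T-∧; T-∨; T?) renaming (_≟_ to _≟ᵇ_)
open import Data.Empty using (⊥-elim)
open import Data.Fin using (#_)
open import Data.Fin.Base using (Fin; zero; suc; toℕ; inject₁; fromℕ; _↑ʳ_)
open import Data.Fin.Properties using (all?; toℕ-injective; toℕ-inject₁; toℕ-fromℕ; _≟_)
open import Data.Fin.Relation.Unary.Top using (view; ‵fromℕ; ‵inject₁)
open import Data.Fin.Subset using () renaming (_∈_ to _∈ₛ_)
open import Data.Fin.Subset.Properties using (_∈?_)
open import Data.List.Base using (List; []; _∷_; _++_; tabulate)
open import Data.List.Membership.Propositional using (_∈_)
open import Data.List.Properties using (tabulate-cong; ++-identityʳ)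
open import Data.List.Relation.Unary.All as All using (All; []; _∷_)
open import Data.List.Relation.Unary.All.Properties using (all⁺; all⁻)
open import Data.List.Relation.Unary.Any using (here; there)
open import Data.Maybe using (Maybe; just; nothing; Is-just)
open import Data.Maybe.Properties using (≡-dec)
import Data.Maybe.Relation.Unary.Any as Any
open import Data.Nat.Base using (ℕ; zero; suc; _+_; _*_; _^_; _≤_; z≤n; s≤s; _≡ᵇ_; >-nonZero)
open import Data.Nat.Properties
  using ( ≤-refl; ≤-reflexive; ≤-trans; m≤m+n; m≤n+m; m≤n⇒m≤1+n; +-mono-≤; +-monoˡ-≤; +-monoʳ-≤
        ; *-monoˡ-≤; *-monoʳ-≤; ^-monoʳ-≤; +-assoc; *-identityʳ; *-distribʳ-+; ≡ᵇ⇒≡; ≡⇒≡ᵇ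
        ; +-commutativeSemigroup; *-commutativeSemigroup; module ≤-Reasoning)
open import Data.Product.Base using (Σ-syntax; ∃-syntax; _×_; _,_; proj₁; proj₂)
open import Data.Sum.Base using (_⊎_; inj₁; inj₂; [_,_]′; map)
open import Data.Unit.Base using (⊤; tt)
open import Data.Vec.Base as Vec using (Vec; []; _∷_; lookup)
open import Data.Vec.Properties using (lookup∘tabulate)
open import Data.Vec.Relation.Unary.All using ([]; _∷_) renaming (All to Allᵛ)
open import Data.Vec.Relation.Unary.All.Properties using (lookup⁺)
open import Function.Base using (_∘_)
open import Function.Bundles using (Equivalence)
open import Level using (0ℓ; lift)
open import Relation.Binary.Core using (Rel)
open import Relation.Binary.Definitions using (Trichotomous; tri<; tri≈; tri>)
open import Relation.Binary.PropositionalEquality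
  using (_≡_; _≢_; refl; sym; trans; cong; cong₂; subst; subst₂; isEquivalence; resp₂)
open import Relation.Binary.Structures using (IsPartialOrder; IsStrictPartialOrder)
open import Relation.Nullary.Decidable
  using (Dec; yes; no; does; from-yes; toWitness; fromWitness; _→-dec_; ⌊_⌋; isYes≗does; does-≡)
open import Relation.Nullary.Negation using (¬_; contradiction)
open import Defs
open Equivalence using (to; from)
open BT using (x; y; z; α; β; γ; δ; ε)

-- A language of bounded loops

-- As in the safe recursion of Bellantoni and Cook, a loop may only run along a
-- normal value.  All normal values are subtrees of the input, loop counters
-- included, so no loop is longer than the size of the input; the results of
-- loops are safe.
data Kind : Set where
  normal safe : Kind

private variable
  A : Set
  n m p N : ℕ
  k : Kind
  t u v : Tree
  b c : Bool

-- `nvar`, `hd` and `tl` are available at every kind, so that a normal value can also stand where a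
-- safe one is expected.
data Term (n m : ℕ) : Kind → Set where
  nvar  : ∀ {k} → Fin n → Term n m k
  svar  : Fin m → Term n m safe
  nil   : Term n m safe
  cons  : Term n m safe → Term n m safe → Term n m safe
  hd tl : ∀ {k} → Term n m k → Term n m k
  ite   : Term n m safe → Term n m safe → Term n m safe → Term n m safe
  iter  : Term n m normal → Term n m safe → Term (suc n) (suc m) safe → Term n m safe

head tail : Tree → Tree
head nil     = nil
head (s ∙ t) = s
tail nil     = nil
tail (s ∙ t) = t

branch : {A : Set} → Tree → A → A → A
branch nil     u v = v
branch (_ ∙ _) u v = u

-- On codeℕ n the counter t takes the values codeℕ (n - 1), …, codeℕ 0.
iterate : (Tree → Tree → Tree) → Tree → Tree → Tree
iterate f nil     a = a
iterate f (_ ∙ t) a = iterate f t (f t a)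

⟦_⟧ : Term n m k → Vec Tree n → Vec Tree m → Tree
⟦ nvar i ⟧     ν σ = lookup ν i
⟦ svar i ⟧     ν σ = lookup σ i
⟦ nil ⟧        ν σ = nil
⟦ cons d e ⟧   ν σ = ⟦ d ⟧ ν σ ∙ ⟦ e ⟧ ν σ
⟦ hd e ⟧       ν σ = head (⟦ e ⟧ ν σ)
⟦ tl e ⟧       ν σ = tail (⟦ e ⟧ ν σ)
⟦ ite c d e ⟧  ν σ = branch (⟦ c ⟧ ν σ) (⟦ d ⟧ ν σ) (⟦ e ⟧ ν σ)
⟦ iter l b s ⟧ ν σ =
  iterate (λ t a → ⟦ s ⟧ (t ∷ ν) (a ∷ σ)) (⟦ l ⟧ ν σ) (⟦ b ⟧ ν σ)

-- An interpreter for the language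

encode : Term n m k → Tree
encode nil          = nil
encode (nvar i)     = codeℕ 0 ∙ codeℕ (toℕ i)
encode (svar i)     = codeℕ 1 ∙ codeℕ (toℕ i)
encode (hd e)       = codeℕ 2 ∙ encode e
encode (tl e)       = codeℕ 3 ∙ encode e
encode (cons d e)   = codeℕ 4 ∙ (encode d ∙ encode e)
encode (ite c d e)  = codeℕ 5 ∙ (encode c ∙ (encode d ∙ encode e))
encode (iter l b s) = codeℕ 6 ∙ (encode l ∙ (encode b ∙ encode s))

arity : Fin 3 → ℕ
arity zero             = 2
arity (suc zero)       = 3
arity (suc (suc zero)) = 5

pattern lookF = zero
pattern evalF = suc zero
pattern loopF = suc (suc zero)

private
  eval : Exp arity n → Exp arity n → Exp arity n → Exp arity n
  eval e ν σ = call evalF (e ∷ ν ∷ σ ∷ [])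

quoteTree : Tree → Exp arity n
quoteTree nil     = nil
quoteTree (s ∙ t) = cons (quoteTree s) (quoteTree t)

-- The arguments are (environment, index) for lookF, (code, normal environment,
-- safe environment) for evalF and (list, accumulator, code of the step, normal
-- environment, safe environment) for loopF.  evalF finds the tag by peeling off
-- one unit per case, and each case shifts the variables by two.
body : ∀ f → Exp arity (arity f)
body lookF =
  case (var (# 1))
    (case (var (# 0)) nil (var (# 0)))
    (case (var (# 2)) nil (call lookF (var (# 1) ∷ var (# 3) ∷ [])))
body evalF =
  case (var (# 0)) nil
  (case (var (# 0)) (call lookF (var (# 3) ∷ var (# 1) ∷ []))
  (case (var (# 1)) (call lookF (var (# 6) ∷ var (# 3) ∷ []))
  (case (var (# 1)) (case (eval (var (# 5)) (var (# 7)) (var (# 8))) nil (var (# 0)))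
  (case (var (# 1)) (case (eval (var (# 7)) (var (# 9)) (var (# 10))) nil (var (# 1)))
  (case (var (# 1))
    (case (var (# 9)) nil
      (cons (eval (var (# 0)) (var (# 13)) (var (# 14)))
            (eval (var (# 1)) (var (# 13)) (var (# 14)))))
  (case (var (# 1))
    (case (var (# 11)) nil
      (case (eval (var (# 0)) (var (# 15)) (var (# 16)))
        (case (var (# 1)) nil (eval (var (# 1)) (var (# 17)) (var (# 18))))
        (case (var (# 3)) nil (eval (var (# 0)) (var (# 19)) (var (# 20))))))
    (case (var (# 13)) nil
      (case (var (# 1)) nil
        (call loopF
          ( eval (var (# 2)) (var (# 19)) (var (# 20))
          ∷ eval (var (# 0)) (var (# 19)) (var (# 20))
          ∷ var (# 1) ∷ var (# 19) ∷ var (# 20) ∷ []))))))))))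
body loopF =
  case (var (# 0)) (var (# 1))
    (call loopF
      ( var (# 1)
      ∷ eval (var (# 4)) (cons (var (# 1)) (var (# 5))) (cons (var (# 3)) (var (# 6)))
      ∷ var (# 4) ∷ var (# 5) ∷ var (# 6) ∷ []))

-- The code of `e` is a constant of `main`, so the time to build it does not depend on the input.
interpreter : Term 1 0 safe → Program
interpreter e = record
  { #functions = 3
  ; arity      = arity
  ; body       = body
  ; main       = call evalF (quoteTree (encode e) ∷ cons (var zero) nil ∷ nil ∷ [])
  }

-- Exact running time of the interpreter

lookCost : ℕ → ℕ
lookCost zero    = 5
lookCost (suc i) = 7 + lookCost i

mutual
  -- The constants count the steps of `body evalF` around the recursive calls, two for each `case`
  -- on a variable. Sums are bracketed as the evaluation rules produce them, so that `⇓eval`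
  -- involves no arithmetic.
  cost : Term n m k → Vec Tree n → Vec Tree m → ℕ
  cost nil          ν σ = 3
  cost (nvar i)     ν σ = 7 + lookCost (toℕ i)
  cost (svar i)     ν σ = 9 + lookCost (toℕ i)
  cost (hd e)       ν σ = 13 + (cost e ν σ + 1)
  cost (tl e)       ν σ = 15 + (cost e ν σ + 1)
  cost (cons d e)   ν σ = 19 + (cost d ν σ + (4 + cost e ν σ))
  cost (ite c d e)  ν σ =
    21 + (cost c ν σ + (6 + branch (⟦ c ⟧ ν σ) (cost d ν σ) (cost e ν σ)))
  cost (iter l b s) ν σ =
    23 + (cost l ν σ + (4 + (cost b ν σ + 3)) + loopCost s ν σ (⟦ l ⟧ ν σ) (⟦ b ⟧ ν σ))

  loopCost : Term (suc n) (suc m) safe → Vec Tree n → Vec Tree m → Tree → Tree → ℕ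
  loopCost s ν σ nil     a = 3
  loopCost s ν σ (_ ∙ t) a =
    12 + (cost s (t ∷ ν) (a ∷ σ) + 3 + loopCost s ν σ t (⟦ s ⟧ (t ∷ ν) (a ∷ σ)))

codeVec : Vec Tree n → Tree
codeVec []      = nil
codeVec (v ∷ ν) = v ∙ codeVec ν

quoteCost : Tree → ℕ
quoteCost nil     = 1
quoteCost (s ∙ t) = suc (quoteCost s + quoteCost t)

module _ (program : Term 1 0 safe) where
  open Semantics (interpreter program)

  ⇓quote : ∀ {ρ : Vec Tree n} t → ρ ⊢ quoteTree t ⇓ t ⟨ quoteCost t ⟩
  ⇓quote nil     = ⇓nil
  ⇓quote (s ∙ t) = ⇓cons (⇓quote s) (⇓quote t)

  private
    pattern ∙case d   = ⇓case-∙ ⇓var d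
    pattern nilcase d = ⇓case-nil ⇓var d

    pattern tag₀ d = ∙case (nilcase d)
    pattern tag₁ d = ∙case (tag₀ d)
    pattern tag₂ d = ∙case (tag₁ d)
    pattern tag₃ d = ∙case (tag₂ d)
    pattern tag₄ d = ∙case (tag₃ d)
    pattern tag₅ d = ∙case (tag₄ d)
    -- One test of the code itself and six failed tests of the tag: 6 is the tag that remains.
    pattern tag₆ d = ∙case (∙case (∙case (∙case (∙case (∙case (∙case d))))))

    pattern callLook d = ⇓call (⇓∷ ⇓var (⇓∷ ⇓var ⇓[])) d
    pattern callEval d = ⇓call (⇓∷ ⇓var (⇓∷ ⇓var (⇓∷ ⇓var ⇓[]))) d

  ⇓look : (ν : Vec Tree n) (i : Fin n) →
          (codeVec ν ∷ codeℕ (toℕ i) ∷ []) ⊢ body lookF ⇓ lookup ν i ⟨ lookCost (toℕ i) ⟩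
  ⇓look (v ∷ ν) zero    = nilcase (∙case ⇓var)
  ⇓look (v ∷ ν) (suc i) = ∙case (∙case (callLook (⇓look ν i)))

  mutual
    ⇓eval : (e : Term n m k) (ν : Vec Tree n) (σ : Vec Tree m) →
            (encode e ∷ codeVec ν ∷ codeVec σ ∷ []) ⊢ body evalF ⇓ ⟦ e ⟧ ν σ ⟨ cost e ν σ ⟩
    ⇓eval nil        ν σ = nilcase ⇓nil
    ⇓eval (nvar i)   ν σ = tag₀ (callLook (⇓look ν i))
    ⇓eval (svar i)   ν σ = tag₁ (callLook (⇓look σ i))
    -- The value is abstracted together with its derivation because it decides which rule for `case`
    -- applies.
    ⇓eval (hd e)     ν σ with ⟦ e ⟧ ν σ | ⇓eval e ν σ
    ... | nil   | d = tag₂ (⇓case-nil (callEval d) ⇓nil)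
    ... | _ ∙ _ | d = tag₂ (⇓case-∙ (callEval d) ⇓var)
    ⇓eval (tl e)     ν σ with ⟦ e ⟧ ν σ | ⇓eval e ν σ
    ... | nil   | d = tag₃ (⇓case-nil (callEval d) ⇓nil)
    ... | _ ∙ _ | d = tag₃ (⇓case-∙ (callEval d) ⇓var)
    ⇓eval (cons d e) ν σ =
      tag₄ (∙case (⇓cons (callEval (⇓eval d ν σ)) (callEval (⇓eval e ν σ))))
    -- `cost` branches on the same value, so the abstraction also reduces it to the cost of the
    -- branch taken.
    ⇓eval (ite c d e) ν σ with ⟦ c ⟧ ν σ | ⇓eval c ν σ
    ... | nil   | q = tag₅ (∙case (⇓case-nil (callEval q) (∙case (callEval (⇓eval e ν σ)))))
    ... | _ ∙ _ | q = tag₅ (∙case (⇓case-∙ (callEval q) (∙case (callEval (⇓eval d ν σ)))))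
    ⇓eval (iter l b s) ν σ =
      tag₆ (∙case (∙case (⇓call
        (⇓∷ (callEval (⇓eval l ν σ))
        (⇓∷ (callEval (⇓eval b ν σ))
        (⇓∷ ⇓var (⇓∷ ⇓var (⇓∷ ⇓var ⇓[])))))
        (⇓loop s ν σ (⟦ l ⟧ ν σ) (⟦ b ⟧ ν σ)))))

    ⇓loop : (s : Term (suc n) (suc m) safe) (ν : Vec Tree n) (σ : Vec Tree m) (t a : Tree) →
            (t ∷ a ∷ encode s ∷ codeVec ν ∷ codeVec σ ∷ []) ⊢ body loopF
              ⇓ iterate (λ u b → ⟦ s ⟧ (u ∷ ν) (b ∷ σ)) t a ⟨ loopCost s ν σ t a ⟩
    ⇓loop s ν σ nil     a = nilcase ⇓var
    ⇓loop s ν σ (_ ∙ t) a =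
      ∙case (⇓call
        (⇓∷ ⇓var
        (⇓∷ (⇓call (⇓∷ ⇓var (⇓∷ (⇓cons ⇓var ⇓var) (⇓∷ (⇓cons ⇓var ⇓var) ⇓[])))
              (⇓eval s (t ∷ ν) (a ∷ σ)))
        (⇓∷ ⇓var (⇓∷ ⇓var (⇓∷ ⇓var ⇓[])))))
        (⇓loop s ν σ t (⟦ s ⟧ (t ∷ ν) (a ∷ σ))))

-- The 4 steps build the environments: three for the list holding the input, one for the empty list.
runTime : Term 1 0 safe → Tree → ℕ
runTime e input = suc (quoteCost (encode e) + 4 + cost e (input ∷ []) [])

⇓runs : (e : Term 1 0 safe) (input : Tree) →
        Runs (interpreter e) input (⟦ e ⟧ (input ∷ []) []) (runTime e input)
⇓runs e input = ⇓call (⇓∷ (⇓quote e (encode e)) (⇓∷ (⇓cons ⇓var ⇓nil) (⇓∷ ⇓nil ⇓[])))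
                      (⇓eval e e (input ∷ []) [])
  where open Semantics (interpreter e)

-- Polynomial bounds on the running time

Sizes≤ : ℕ → Vec Tree n → Set
Sizes≤ N = Allᵛ (λ v → size v ≤ N)

size-positive : ∀ t → 1 ≤ size t
size-positive nil     = ≤-refl
size-positive (_ ∙ _) = s≤s z≤n

size-head : ∀ t → size (head t) ≤ size t
size-head nil     = ≤-refl
size-head (s ∙ t) = m≤n⇒m≤1+n (m≤m+n (size s) (size t))

size-tail : ∀ t → size (tail t) ≤ size t
size-tail nil     = ≤-refl
size-tail (s ∙ t) = m≤n⇒m≤1+n (m≤n+m (size t) (size s))

-- A normal term is a normal variable under heads and tails, so its value is a subtree of an entry
-- of `ν`.
size-normal : (e : Term n m normal) {ν : Vec Tree n} (σ : Vec Tree m) →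
              Sizes≤ N ν → size (⟦ e ⟧ ν σ) ≤ N
size-normal (nvar i) σ bs = lookup⁺ bs i
size-normal (hd e)   σ bs = ≤-trans (size-head (⟦ e ⟧ _ σ)) (size-normal e σ bs)
size-normal (tl e)   σ bs = ≤-trans (size-tail (⟦ e ⟧ _ σ)) (size-normal e σ bs)

-- The sum over both branches of `ite` covers whichever is taken, and `N` bounds the number of
-- rounds of a loop.
bound : Term n m k → ℕ → ℕ
bound nil          N = 3
bound (nvar i)     N = 7 + lookCost (toℕ i)
bound (svar i)     N = 9 + lookCost (toℕ i)
bound (hd e)       N = 13 + (bound e N + 1)
bound (tl e)       N = 15 + (bound e N + 1)
bound (cons d e)   N = 19 + (bound d N + (4 + bound e N))
bound (ite c d e)  N = 21 + (bound c N + (6 + (bound d N + bound e N)))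
bound (iter l b s) N =
  23 + (bound l N + (4 + (bound b N + 3)) + (3 + N * (12 + (bound s N + 3))))

mutual
  -- Nothing is assumed of the sizes in `σ`: safe values never determine the length of a loop, and a
  -- step costs one unit however large its values are.
  cost≤bound : (e : Term n m k) {ν : Vec Tree n} (σ : Vec Tree m) →
               Sizes≤ N ν → cost e ν σ ≤ bound e N
  cost≤bound nil          σ bs = ≤-refl
  cost≤bound (nvar i)     σ bs = ≤-refl
  cost≤bound (svar i)     σ bs = ≤-refl
  cost≤bound (hd e)       σ bs = +-monoʳ-≤ 13 (+-monoˡ-≤ 1 (cost≤bound e σ bs))
  cost≤bound (tl e)       σ bs = +-monoʳ-≤ 15 (+-monoˡ-≤ 1 (cost≤bound e σ bs))
  cost≤bound (cons d e)   σ bs =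
    +-monoʳ-≤ 19 (+-mono-≤ (cost≤bound d σ bs) (+-monoʳ-≤ 4 (cost≤bound e σ bs)))
  cost≤bound (ite c d e) {ν} σ bs =
    +-monoʳ-≤ 21 (+-mono-≤ (cost≤bound c σ bs) (+-monoʳ-≤ 6
      (branch≤+ (⟦ c ⟧ ν σ) (cost≤bound d σ bs) (cost≤bound e σ bs))))
    where
    branch≤+ : ∀ t {u u′ v v′} → u ≤ u′ → v ≤ v′ → branch t u v ≤ u′ + v′
    branch≤+ nil     {u′ = u′} p q = ≤-trans q (m≤n+m _ u′)
    branch≤+ (_ ∙ _) p q = ≤-trans p (m≤m+n _ _)
  cost≤bound {N = N} (iter l b s) {ν} σ bs =
    +-monoʳ-≤ 23 (+-mono-≤
      (+-mono-≤ (cost≤bound l σ bs) (+-monoʳ-≤ 4 (+-monoˡ-≤ 3 (cost≤bound b σ bs))))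
      (≤-trans (loopCost≤ s σ bs (⟦ l ⟧ ν σ) (⟦ b ⟧ ν σ) l≤N)
               (+-monoʳ-≤ 3 (*-monoˡ-≤ (12 + (bound s N + 3)) l≤N))))
    where l≤N = size-normal l σ bs

  -- A list has at most as many entries as its size. The rest of the list is a subtree, so the
  -- normal environment of the next round still satisfies the bound `N`.
  loopCost≤ : (s : Term (suc n) (suc m) safe) {ν : Vec Tree n} (σ : Vec Tree m) →
              Sizes≤ N ν → ∀ t a → size t ≤ N →
              loopCost s ν σ t a ≤ 3 + size t * (12 + (bound s N + 3))
  loopCost≤ s σ bs nil     a t≤N = m≤m+n 3 _
  loopCost≤ {N = N} s {ν} σ bs (h ∙ t) a h∙t≤N = begin
    12 + (cost s (t ∷ ν) (a ∷ σ) + 3 + loopCost s ν σ t _)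
      ≤⟨ +-monoʳ-≤ 12 (+-mono-≤ (+-monoˡ-≤ 3 (cost≤bound s (a ∷ σ) (t≤N ∷ bs)))
                                (loopCost≤ s σ bs t _ t≤N)) ⟩
    12 + (bound s N + 3 + (3 + size t * K))
      ≡⟨ +-assoc 12 (bound s N + 3) _ ⟨
    K + (3 + size t * K)
      ≡⟨ x∙yz≈y∙xz +-commutativeSemigroup K 3 (size t * K) ⟩
    3 + (K + size t * K)
      ≤⟨ +-monoʳ-≤ 3 (*-monoˡ-≤ K (s≤s (m≤n+m (size t) (size h)))) ⟩
    3 + size (h ∙ t) * K ∎
    where
    open ≤-Reasoning
    K = 12 + (bound s N + 3)
    t≤N = ≤-trans (size-tail (h ∙ t)) h∙t≤N

-- For `1 ≤ N` raising the exponent does not decrease the power; at 0 this fails, and sizes of trees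
-- are positive.
PolynomiallyBounded : (ℕ → ℕ) → Set
PolynomiallyBounded p = ∃[ c ] ∃[ k ] (∀ N → 1 ≤ N → p N ≤ c * N ^ k)

const-poly : ∀ c → PolynomiallyBounded (λ _ → c)
const-poly c = c , 0 , λ N _ → ≤-reflexive (sym (*-identityʳ c))

infixl 6 _+-poly_

_+-poly_ : ∀ {p q} → PolynomiallyBounded p → PolynomiallyBounded q →
           PolynomiallyBounded (λ N → p N + q N)
_+-poly_ {p} {q} (c , k , p≤) (d , l , q≤) = c + d , k + l , λ N 1≤N → let open ≤-Reasoning in begin
  p N + q N                         ≤⟨ +-mono-≤ (p≤ N 1≤N) (q≤ N 1≤N) ⟩
  c * N ^ k + d * N ^ l             ≤⟨ +-mono-≤ (*-monoʳ-≤ c (^-monoʳ-≤ N ⦃ >-nonZero 1≤N ⦄ (m≤m+n k l)))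
                                                (*-monoʳ-≤ d (^-monoʳ-≤ N ⦃ >-nonZero 1≤N ⦄ (m≤n+m l k))) ⟩
  c * N ^ (k + l) + d * N ^ (k + l) ≡⟨ *-distribʳ-+ (N ^ (k + l)) c d ⟨
  (c + d) * N ^ (k + l)             ∎

id*-poly : ∀ {p} → PolynomiallyBounded p → PolynomiallyBounded (λ N → N * p N)
id*-poly {p} (c , k , p≤) = c , suc k , λ N 1≤N → let open ≤-Reasoning in begin
  N * p N         ≤⟨ *-monoʳ-≤ N (p≤ N 1≤N) ⟩
  N * (c * N ^ k) ≡⟨ x∙yz≈y∙xz *-commutativeSemigroup N c (N ^ k) ⟩
  c * (N * N ^ k) ∎

bound-poly : (e : Term n m k) → PolynomiallyBounded (bound e)
bound-poly nil          = const-poly _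
bound-poly (nvar i)     = const-poly _
bound-poly (svar i)     = const-poly _
bound-poly (hd e)       = const-poly 13 +-poly (bound-poly e +-poly const-poly 1)
bound-poly (tl e)       = const-poly 15 +-poly (bound-poly e +-poly const-poly 1)
bound-poly (cons d e)   = const-poly 19 +-poly (bound-poly d +-poly (const-poly 4 +-poly bound-poly e))
bound-poly (ite c d e)  =
  const-poly 21 +-poly (bound-poly c +-poly (const-poly 6 +-poly (bound-poly d +-poly bound-poly e)))
bound-poly (iter l b s) =
  const-poly 23 +-poly
    (bound-poly l +-poly (const-poly 4 +-poly (bound-poly b +-poly const-poly 3)) +-poly
      (const-poly 3 +-poly id*-poly (const-poly 12 +-poly (bound-poly s +-poly const-poly 3))))

-- This disposes of running times: what remains is a term whose value is the code of a correct
-- answer.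
term-polyTimeSolvable :
  ∀ {Input : Set₁} {Output : Input → Set₁} {codeIn codeOut Correct} (e : Term 1 0 safe) →
  (∀ i → Σ[ o ∈ Output i ] (Correct i o × ⟦ e ⟧ (codeIn i ∷ []) [] ≡ codeOut i o)) →
  PolyTimeSolvable Input Output codeIn codeOut Correct
term-polyTimeSolvable {codeIn = codeIn} {codeOut} e solve =
  let c , k , runTime≤ = const-poly (suc (quoteCost (encode e) + 4)) +-poly bound-poly e in
  interpreter e , c , k , λ i →
  let o , correct , ⟦e⟧≡ = solve i in
  o , runTime e (codeIn i) , correct ,
  subst (λ v → Runs (interpreter e) (codeIn i) v _) ⟦e⟧≡ (⇓runs e (codeIn i)) ,
  ≤-trans (+-monoʳ-≤ (suc (quoteCost (encode e) + 4)) (cost≤bound e [] (≤-refl ∷ [])))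
          (runTime≤ (size (codeIn i)) (size-positive (codeIn i)))

-- Folds over finite index sets

-- The indices are visited downwards, in the order of the counters of `iterate` on `codeℕ n`.
foldFin : ∀ n → (Fin n → A → A) → A → A
foldFin zero    f a = a
foldFin (suc n) f a = foldFin n (f ∘ inject₁) (f (fromℕ n) a)

foldFin-preserves : (P : A → Set) {f : Fin n → A → A} →
                    (∀ i {a} → P a → P (f i a)) → ∀ {a} → P a → P (foldFin n f a)
foldFin-preserves {n = zero}  P pres p = p
foldFin-preserves {n = suc n} P pres p = foldFin-preserves P (pres ∘ inject₁) (pres (fromℕ n) p)

-- `Q i` becomes true at the visit of `i`, where the invariant `P` is at hand, and survives all
-- other visits.
foldFin-establishes : (P : A → Set) (Q : Fin n → A → Set) {f : Fin n → A → A} →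
                      (∀ i {a} → P a → P (f i a)) →
                      (∀ i {a} → P a → Q i (f i a)) →
                      (∀ i j {a} → Q i a → Q i (f j a)) →
                      ∀ {a} → P a → ∀ i → Q i (foldFin n f a)
foldFin-establishes {n = suc n} P Q presP est presQ p i with view i
-- The largest index is visited first, so its property has to survive the rest of the fold.
... | ‵fromℕ     = foldFin-preserves (Q (fromℕ n)) (presQ (fromℕ n) ∘ inject₁) (est (fromℕ n) p)
... | ‵inject₁ i =
  foldFin-establishes P (Q ∘ inject₁) (presP ∘ inject₁) (est ∘ inject₁)
    (λ i j → presQ (inject₁ i) (inject₁ j)) (presP (fromℕ n) p) i

anyFin : (Fin n → Bool) → Bool
anyFin f = foldFin _ (λ i b → f i ∨ b) false

anyFin⁺ : (f : Fin n → Bool) → ∀ i → T (f i) → T (anyFin f)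
anyFin⁺ f = foldFin-establishes (λ _ → ⊤) (λ i b → T (f i) → T b) _
  (λ i {b} _ t → from (T-∨ {f i} {b}) (inj₁ t))
  (λ i j {b} q t → from (T-∨ {f j} {b}) (inj₂ (q t)))
  _

anyFin⁻ : (f : Fin n → Bool) → T (anyFin f) → ∃[ i ] T (f i)
anyFin⁻ f = foldFin-preserves (λ b → T b → ∃[ i ] T (f i))
  (λ i {b} ih t → [ (i ,_) , ih ]′ (to (T-∨ {f i} {b}) t)) λ ()

T-not⁻ : ∀ {b} → T (not b) → ¬ T b
T-not⁻ {false} _ ()

T-not⁺ : ∀ {b} → ¬ T b → T (not b)
T-not⁺ {false} _  = _
T-not⁺ {true}  ¬t = ¬t _

-- Extending a partial order pair by pair

BoolRel : ℕ → Set
BoolRel n = Fin n → Fin n → Bool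

Holds : BoolRel n → Rel (Fin n) 0ℓ
Holds R a b = T (R a b)

-- If R is a partial order, this is the transitive closure of R ∪ {(i , j)},
-- since a path need not use the new pair twice; it is taken only if c i j and
-- R j i fails, so that antisymmetry survives.
extend : BoolRel n → Fin n → Fin n → BoolRel n → BoolRel n
extend c i j R a b = R a b ∨ (c i j ∧ (not (R j i) ∧ (R a i ∧ R j b)))

sweep : BoolRel n → BoolRel n → BoolRel n
sweep {n} c = foldFin n λ i → foldFin n λ j → extend c i j

module _ {n} (c : BoolRel n) (i j : Fin n) {R : BoolRel n} where

  extend⁻ : ∀ {a b} → Holds (extend c i j R) a b →
            Holds R a b ⊎ (T (c i j) × ¬ Holds R j i × Holds R a i × Holds R j b)
  extend⁻ {a} {b} t with to (T-∨ {R a b}) t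
  ... | inj₁ r = inj₁ r
  ... | inj₂ u with to (T-∧ {c i j}) u
  ...   | cij , u with to (T-∧ {not (R j i)}) u
  ...     | ¬ji , u with to (T-∧ {R a i}) u
  ...       | ai , jb = inj₂ (cij , T-not⁻ ¬ji , ai , jb)

  extend-⊇ : ∀ {a b} → Holds R a b → Holds (extend c i j R) a b
  extend-⊇ {a} {b} r = from (T-∨ {R a b}) (inj₁ r)

  extend-new : ∀ {a b} → T (c i j) → ¬ Holds R j i → Holds R a i → Holds R j b →
               Holds (extend c i j R) a b
  extend-new {a} {b} cij ¬ji ai jb = from (T-∨ {R a b}) (inj₂
    (from (T-∧ {c i j}) (cij , from (T-∧ {not (R j i)}) (T-not⁺ ¬ji , from (T-∧ {R a i}) (ai , jb)))))

  -- In each case a cycle through the new pair contains a path in `R` from `j` back to `i`, which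
  -- the guard excludes.
  extend-isPartialOrder : IsPartialOrder _≡_ (Holds R) → IsPartialOrder _≡_ (Holds (extend c i j R))
  extend-isPartialOrder po = record
    { isPreorder = record
      { isEquivalence = isEquivalence
      ; reflexive     = extend-⊇ ∘ po.reflexive
      ; trans         = λ ab bc → trans′ (extend⁻ ab) (extend⁻ bc)
      }
    ; antisym = λ ab ba → antisym′ (extend⁻ ab) (extend⁻ ba)
    }
    where
    module po = IsPartialOrder po
    Step : Rel (Fin n) 0ℓ
    Step a b = Holds R a b ⊎ (T (c i j) × ¬ Holds R j i × Holds R a i × Holds R j b)

    trans′ : ∀ {a b d} → Step a b → Step b d → Holds (extend c i j R) a d
    trans′ (inj₁ ab) (inj₁ bd) = extend-⊇ (po.trans ab bd)
    trans′ (inj₁ ab) (inj₂ (cij , ¬ji , bi , jd)) = extend-new cij ¬ji (po.trans ab bi) jd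
    trans′ (inj₂ (cij , ¬ji , ai , jb)) (inj₁ bd) = extend-new cij ¬ji ai (po.trans jb bd)
    trans′ (inj₂ (cij , ¬ji , ai , _)) (inj₂ (_ , _ , _ , jd)) = extend-new cij ¬ji ai jd

    antisym′ : ∀ {a b} → Step a b → Step b a → a ≡ b
    antisym′ (inj₁ ab) (inj₁ ba) = po.antisym ab ba
    antisym′ (inj₁ ab) (inj₂ (_ , ¬ji , bi , ja)) = ⊥-elim (¬ji (po.trans ja (po.trans ab bi)))
    antisym′ (inj₂ (_ , ¬ji , ai , jb)) (inj₁ ba) = ⊥-elim (¬ji (po.trans jb (po.trans ba ai)))
    antisym′ (inj₂ (_ , ¬ji , ai , jb)) (inj₂ (_ , _ , bi , ja)) = ⊥-elim (¬ji (po.trans jb bi))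

sweep-preserves : (P : BoolRel n → Set) (c : BoolRel n) →
                  (∀ i j {R} → P R → P (extend c i j R)) → ∀ {R} → P R → P (sweep c R)
sweep-preserves P c pres = foldFin-preserves P λ i → foldFin-preserves P (pres i)

sweep-establishes : (P : BoolRel n → Set) (Q : Fin n → Fin n → BoolRel n → Set) (c : BoolRel n) →
                    (∀ i j {R} → P R → P (extend c i j R)) →
                    (∀ i j {R} → P R → Q i j (extend c i j R)) →
                    (∀ a b i j {R} → Q a b R → Q a b (extend c i j R)) →
                    ∀ {R} → P R → ∀ i j → Q i j (sweep c R)
sweep-establishes P Q c presP est presQ p i =
  foldFin-establishes P (λ i R → ∀ j → Q i j R)
    (λ i → foldFin-preserves P (presP i))
    (λ i → foldFin-establishes P (Q i) (presP i) (est i) (λ j → presQ i j i))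
    (λ i i′ q j → foldFin-preserves (Q i j) (presQ i j i′) (q j))
    p i

-- Numerals are compared, as in the term `equalT`.
identity : BoolRel n
identity a b = toℕ a ≡ᵇ toℕ b

identity⁻ : ∀ {a b : Fin n} → Holds identity a b → a ≡ b
identity⁻ = toℕ-injective ∘ ≡ᵇ⇒≡ _ _

identity-isPartialOrder : IsPartialOrder _≡_ (Holds (identity {n}))
identity-isPartialOrder = record
  { isPreorder = record
    { isEquivalence = isEquivalence
    ; reflexive     = λ { {a} refl → ≡⇒≡ᵇ (toℕ a) (toℕ a) refl }
    ; trans         = λ {a} ab bc → subst (Holds identity a) (identity⁻ bc) ab
    }
  ; antisym = λ ab _ → identity⁻ ab
  }

-- Linear extensions and unsatisfiable constraints

always : BoolRel n
always _ _ = true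

-- The second sweep is a finite form of Szpilrajn's extension theorem.
linearExtension : BoolRel n → BoolRel n
linearExtension c = sweep always (sweep c identity)

-- Skipped pairs are not recorded during the sweep; they are detected on the finished order, whose
-- totality makes this the test for a pair of `c` that is not strictly respected.
violated : BoolRel n → Bool
violated c = anyFin λ a → anyFin λ b → c a b ∧ linearExtension c b a

module _ (c : BoolRel n) where

  private
    sweep-isPartialOrder : IsPartialOrder _≡_ (Holds (sweep c identity))
    sweep-isPartialOrder =
      sweep-preserves (λ R → IsPartialOrder _≡_ (Holds R)) c (extend-isPartialOrder c)
        identity-isPartialOrder

  linearExtension-isPartialOrder : IsPartialOrder _≡_ (Holds (linearExtension c))
  linearExtension-isPartialOrder =
    sweep-preserves (λ R → IsPartialOrder _≡_ (Holds R)) always (extend-isPartialOrder always) sweep-isPartialOrder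

  private module po = IsPartialOrder linearExtension-isPartialOrder

  -- When `always` visits `(i , j)`, either `R j i` holds already or the pair is added; later steps
  -- only enlarge the relation.
  linearExtension-total : ∀ a b → Holds (linearExtension c) a b ⊎ Holds (linearExtension c) b a
  linearExtension-total =
    sweep-establishes (λ R → IsPartialOrder _≡_ (Holds R)) (λ a b R → Holds R a b ⊎ Holds R b a) always
      (extend-isPartialOrder always)
      (λ i j {R} po → total-at i j po (T? (R j i)))
      (λ a b i j {R} → map (extend-⊇ always i j {R}) (extend-⊇ always i j {R}))
      sweep-isPartialOrder
    where
    total-at : ∀ i j {R} → IsPartialOrder _≡_ (Holds R) → Dec (Holds R j i) →
               let R′ = extend always i j R in Holds R′ i j ⊎ Holds R′ j i
    total-at i j {R} po (yes ji) = inj₂ (extend-⊇ always i j {R} ji)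
    total-at i j {R} po (no ¬ji) =
      inj₁ (extend-new always i j {R} _ ¬ji (IsPartialOrder.refl po) (IsPartialOrder.refl po))

  -- By totality the complement of the converse is the strict part. In this form its table arises by
  -- negating entries.
  strict : TotalOrder n
  strict = record
    { _≺_ = λ a b → T (not (linearExtension c b a))
    ; isStrictTotalOrder = record
      { isStrictPartialOrder = record
        { isEquivalence = isEquivalence
        ; irrefl        = λ { refl ¬aa → T-not⁻ ¬aa po.refl }
        ; trans         = λ {a} {b} {d} ¬ba ¬db → T-not⁺ λ da →
            [ (λ ab → T-not⁻ ¬db (po.trans da ab)) , T-not⁻ ¬ba ]′ (linearExtension-total a b)
        ; <-resp-≈      = resp₂ _
        }
      ; compare = compare
      }
    }
    where
    compare : Trichotomous _≡_ (λ a b → T (not (linearExtension c b a)))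
    compare a b with a ≟ b
    ... | yes refl = tri≈ (λ ¬aa → T-not⁻ ¬aa po.refl) refl (λ ¬aa → T-not⁻ ¬aa po.refl)
    ... | no a≢b with linearExtension-total a b
    ...   | inj₁ ab = tri< (T-not⁺ λ ba → a≢b (po.antisym ab ba)) a≢b (λ ¬ab → T-not⁻ ¬ab ab)
    ...   | inj₂ ba = tri> (λ ¬ba → T-not⁻ ¬ba ba) a≢b (T-not⁺ λ ab → a≢b (po.antisym ab ba))

  ¬violated⇒strict-extends : ¬ T (violated c) → ∀ {a b} → T (c a b) → TotalOrder._≺_ strict a b
  ¬violated⇒strict-extends ¬v {a} {b} cab = T-not⁺ λ ba →
    ¬v (anyFin⁺ _ a (anyFin⁺ _ b (from (T-∧ {c a b}) (cab , ba))))

  -- If `O` respected `c`, the guard would never reject a pair of `c`, so the violating pair would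
  -- be related in both directions, hence equal, against irreflexivity of `O`.
  violated⇒no-extension : T (violated c) → (O : TotalOrder n) →
                          ¬ (∀ a b → T (c a b) → TotalOrder._≺_ O a b)
  violated⇒no-extension v O c⊆O with anyFin⁻ _ v
  ... | a , v′ with anyFin⁻ _ v′
  ...   | b , v″ with to (T-∧ {c a b}) v″
  ...     | cab , ba = O.irrefl (po.antisym ab ba) (c⊆O a b cab)
    where
    module O = TotalOrder O

    Contained : BoolRel n → Set
    Contained R = ∀ {a b} → Holds R a b → a ≡ b ⊎ a O.≺ b

    then≺ : ∀ {a b d} → a ≡ b ⊎ a O.≺ b → b O.≺ d → a O.≺ d
    then≺ (inj₁ refl) q = q
    then≺ (inj₂ p)    q = O.trans p q

    ≺then : ∀ {a b d} → a O.≺ b → b ≡ d ⊎ b O.≺ d → a O.≺ d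
    ≺then p (inj₁ refl) = p
    ≺then p (inj₂ q)    = O.trans p q

    contained-extend : ∀ i j {R} → Contained R → Contained (extend c i j R)
    contained-extend i j {R} R⊆O t with extend⁻ c i j {R} t
    ... | inj₁ r = R⊆O r
    ... | inj₂ (cij , _ , ai , jb) = inj₂ (≺then (then≺ (R⊆O ai) (c⊆O i j cij)) (R⊆O jb))

    Invariant : BoolRel n → Set
    Invariant R = IsPartialOrder _≡_ (Holds R) × Contained R

    ab : Holds (linearExtension c) a b
    ab = sweep-preserves (λ R → Holds R a b) always (λ i j {R} → extend-⊇ always i j {R})
      (sweep-establishes Invariant (λ i j R → T (c i j) → Holds R i j) c
        (λ i j (po , R⊆O) → extend-isPartialOrder c i j po , contained-extend i j R⊆O)
        (λ i j {R} (po , R⊆O) cij → extend-new c i j {R} cij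
          -- The guard cannot block: `R j i` would give `j = i` or `j ≺ i` in `O`, while `i ≺ j`.
          (λ ji → O.irrefl refl (≺then (c⊆O i j cij) (R⊆O ji)))
          (IsPartialOrder.refl po) (IsPartialOrder.refl po))
        (λ a b i j {R} q cab → extend-⊇ c i j {R} (q cab))
        (identity-isPartialOrder , inj₁ ∘ identity⁻)
        a b cab)

-- Edges of the pattern and forced pairs

-- The domains of the pattern partition the five values, so a value determines its point.
owner : Fin 5 → Fin 3
owner α = y
owner β = y
owner γ = z
owner δ = z
owner ε = x

∈dom-owner : ∀ a → a ∈ₛ BT.dom (owner a)
∈dom-owner = from-yes (all? λ a → a ∈? BT.dom (owner a))

∈dom⇒owner : ∀ v a → a ∈ₛ BT.dom v → v ≡ owner a
∈dom⇒owner = from-yes (all? λ v → all? λ a → (a ∈? BT.dom v) →-dec (v ≟ owner a))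

edges : List (Fin 5 × Fin 5 × Bool)
edges = (α , γ , false) ∷ (ε , δ , false) ∷
        (α , δ , true) ∷ (β , γ , true) ∷ (α , ε , true) ∷ (ε , γ , true) ∷ []

αγ∈edges : (α , γ , false) ∈ edges
αγ∈edges = here refl

εδ∈edges : (ε , δ , false) ∈ edges
εδ∈edges = there (here refl)

βγ∈edges : (β , γ , true) ∈ edges
βγ∈edges = there (there (there (here refl)))

αε∈edges : (α , ε , true) ∈ edges
αε∈edges = there (there (there (there (here refl))))

cpt-owner : All (λ (a , b , t) → BT.cpt (owner a , a) (owner b , b) ≡ just t) edges
cpt-owner = refl ∷ refl ∷ refl ∷ refl ∷ refl ∷ refl ∷ []

-- `edges` lists each edge in one direction, hence the alternative. The variables are equated as a
-- pair so that one `refl` replaces both.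
cpt⇒edge : ∀ p q {t} → BT.cpt p q ≡ just t →
           ((proj₁ p , proj₁ q) ≡ (owner (proj₂ p) , owner (proj₂ q))) ×
           ((proj₂ p , proj₂ q , t) ∈ edges ⊎ (proj₂ q , proj₂ p , t) ∈ edges)
cpt⇒edge (y , α) (z , γ) refl = refl , inj₁ (here refl)
cpt⇒edge (z , γ) (y , α) refl = refl , inj₂ (here refl)
cpt⇒edge (x , ε) (z , δ) refl = refl , inj₁ (there (here refl))
cpt⇒edge (z , δ) (x , ε) refl = refl , inj₂ (there (here refl))
cpt⇒edge (y , α) (z , δ) refl = refl , inj₁ (there (there (here refl)))
cpt⇒edge (z , δ) (y , α) refl = refl , inj₂ (there (there (here refl)))
cpt⇒edge (y , β) (z , γ) refl = refl , inj₁ (there (there (there (here refl))))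
cpt⇒edge (z , γ) (y , β) refl = refl , inj₂ (there (there (there (here refl))))
cpt⇒edge (y , α) (x , ε) refl = refl , inj₁ (there (there (there (there (here refl)))))
cpt⇒edge (x , ε) (y , α) refl = refl , inj₂ (there (there (there (there (here refl)))))
cpt⇒edge (x , ε) (z , γ) refl = refl , inj₁ (there (there (there (there (there (here refl))))))
cpt⇒edge (z , γ) (x , ε) refl = refl , inj₂ (there (there (there (there (there (here refl))))))

module _ (oi : OrderedInstance) (precedences : List (Fin 3 × Fin 3)) where
  open Instance (proj₁ oi)
  open TotalOrder (proj₂ oi) using (_≺_; _<?_)

  -- `V` and `W` are candidate images of the variables and of the values of the pattern.
  compatible : Vec (Fin #X) 3 → Vec (Fin #D) 5 → Fin 5 → Fin 5 → Maybe Bool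
  compatible V W a b = cpt (lookup V (owner a) , lookup W a) (lookup V (owner b) , lookup W b)

  module _ (V : Vec (Fin #X) 3) (W : Vec (Fin #D) 5) where

    EdgesHold : List (Fin 5 × Fin 5 × Bool) → Set
    EdgesHold = All λ (a , b , t) → compatible V W a b ≡ just t

    PrecedencesHold : Set
    PrecedencesHold = All (λ (v , w) → lookup V v ≺ lookup V w) precedences

    edgeHolds : Fin 5 × Fin 5 × Bool → Bool
    edgeHolds (a , b , t) = ⌊ ≡-dec _≟ᵇ_ (compatible V W a b) (just t) ⌋

    precedenceHolds : Fin 3 × Fin 3 → Bool
    precedenceHolds (v , w) = ⌊ lookup V v <? lookup V w ⌋

    realises : List (Fin 5 × Fin 5 × Bool) → Bool
    realises es = all edgeHolds es ∧ all precedenceHolds precedences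

    realises⁺ : ∀ es → EdgesHold es → PrecedencesHold → T (realises es)
    realises⁺ es hs ps = from (T-∧ {all edgeHolds es})
      (all⁻ edgeHolds (All.map fromWitness hs) , all⁻ precedenceHolds (All.map fromWitness ps))

    realises⁻ : ∀ es → T (realises es) → EdgesHold es × PrecedencesHold
    realises⁻ es r with to (T-∧ {all edgeHolds es}) r
    ... | hs , ps = All.map toWitness (all⁺ edgeHolds es hs) ,
                    All.map toWitness (all⁺ precedenceHolds precedences ps)

  -- Realising the pattern with values a for α and b for β would be an occurrence
  -- if b came before a, so a has to come before b.
  forced : BoolRel #D
  forced a b =
    anyFin λ u → anyFin λ v → anyFin λ w → anyFin λ c → anyFin λ d → anyFin λ e →
      realises (u ∷ v ∷ w ∷ []) (a ∷ b ∷ c ∷ d ∷ e ∷ []) edges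

  forced⁺ : ∀ V W → T (realises V W edges) → T (forced (lookup W α) (lookup W β))
  forced⁺ (u ∷ v ∷ w ∷ []) (a ∷ b ∷ c ∷ d ∷ e ∷ []) r =
    anyFin⁺ _ u (anyFin⁺ _ v (anyFin⁺ _ w (anyFin⁺ _ c (anyFin⁺ _ d (anyFin⁺ _ e r)))))

  forced⁻ : ∀ {a b} → T (forced a b) →
            ∃[ V ] ∃[ W ] (lookup W α ≡ a × lookup W β ≡ b × T (realises V W edges))
  forced⁻ r =
    let u , r = anyFin⁻ _ r ; v , r = anyFin⁻ _ r ; w , r = anyFin⁻ _ r
        c , r = anyFin⁻ _ r ; d , r = anyFin⁻ _ r ; e , r = anyFin⁻ _ r
    in u ∷ v ∷ w ∷ [] , _ ∷ _ ∷ c ∷ d ∷ e ∷ [] , refl , refl , r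

  -- The image of γ is incompatible with that of α and compatible with that of β.
  forced-irrefl : ∀ {a b} → T (forced a b) → a ≢ b
  forced-irrefl r refl =
    let V , W , α≡ , β≡ , r′ = forced⁻ r
        es , _ = realises⁻ V W edges r′
        eq = cong (λ a → cpt (lookup V y , a) (lookup V z , lookup W γ)) (trans α≡ (sym β≡))
    in contradiction (trans (sym (All.lookup es αγ∈edges)) (trans eq (All.lookup es βγ∈edges))) λ ()

-- Occurrences and forced pairs

-- With the respective variable orders this is `BTI` and `BTX` definitionally.
orderedBT : (_<X_ : Rel (Fin 3) 0ℓ) → IsStrictPartialOrder _≡_ _<X_ → Pattern
orderedBT _<X_ isSPO = record
  { structure = BT.structure
  ; _<X_ = _<X_
  ; _<D_ = BT._<D_
  ; <X-isStrictPartialOrder = isSPO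
  ; <D-isStrictPartialOrder = BT.<D-isStrictPartialOrder
  }

module _ (_<X_ : Rel (Fin 3) 0ℓ) (isSPO : IsStrictPartialOrder _≡_ _<X_)
         (precedences : List (Fin 3 × Fin 3))
         (precedences-complete : ∀ v w → v <X w → (v , w) ∈ precedences)
         (precedences-sound : All (λ (v , w) → v <X w) precedences)
         (oi : OrderedInstance) where
  open Instance (proj₁ oi)
  open TotalOrder (proj₂ oi) using (_≺_)

  module _ (D< : TotalOrder #D) where
    open TotalOrder D< using () renaming (_≺_ to _≺ᴰ_; compare to compareᴰ; asym to asymᴰ)

    occurs⇒realises : Occurs (orderedBT _<X_ isSPO) (proj₁ oi) (proj₂ oi) D< →
                      ∃[ V ] ∃[ W ] (EdgesHold oi precedences V W edges × PrecedencesHold oi precedences V W ×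
                                     lookup W β ≺ᴰ lookup W α)
    occurs⇒realises h =
      V , W ,
      All.map (λ {(a , b , t)} eq →
                 trans (cong₂ cpt (at a) (at b)) (preserves-cpt (point a) (point b) t eq))
              cpt-owner ,
      All.map (λ {(v , w)} v<w →
                 subst₂ _≺_ (sym (lookup∘tabulate f-var v)) (sym (lookup∘tabulate f-var w))
                        (preserves-<X v w v<w))
              precedences-sound ,
      preserves-<D (point β) (point α) refl BT.β<α
      where
      open Homomorphism h

      point : Fin 5 → Structure.Point BT.structure
      point a = (owner a , a) , ∈dom-owner a

      V = Vec.tabulate f-var
      W = Vec.tabulate (λ a → val (f (point a)))

      at : ∀ a → (lookup V (owner a) , lookup W a) ≡ proj₁ (f (point a))
      at a = cong₂ _,_ (trans (lookup∘tabulate f-var (owner a)) (sym (f-var-def (point a))))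
                       (lookup∘tabulate (λ a → val (f (point a))) a)

    -- Since `cpt` is defined only between points of distinct variables, the edges show that the
    -- images are points and that `V` is injective: every value lies on an edge, and any two
    -- variables are joined by one.
    realises⇒occurs : ∀ V W → EdgesHold oi precedences V W edges → PrecedencesHold oi precedences V W →
                      lookup W β ≺ᴰ lookup W α →
                      Occurs (orderedBT _<X_ isSPO) (proj₁ oi) (proj₂ oi) D<
    realises⇒occurs V W es ps β<α = record
      { f             = λ ((v , a) , a∈) → (lookup V v , lookup W a) ,
          subst (λ v → lookup W a ∈ₛ dom (lookup V v)) (sym (∈dom⇒owner v a a∈)) (value∈ a)
      ; preserves-cpt = λ (p , _) (q , _) t eq → cpt-preserved p q eq
      ; f-var         = lookup V
      ; f-var-def     = λ _ → refl
      ; f-var-inj     = λ {v} {w} → V-injective v w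
      ; preserves-<X  = λ v w v<w → All.lookup ps (precedences-complete v w v<w)
      ; preserves-<D  = λ { (_ , _) (_ , _) _ BT.β<α → β<α }
      }
      where
      is-just : ∀ {m : Maybe Bool} {t} → m ≡ just t → Is-just m
      is-just refl = Any.just tt

      αγ = cpt-domain _ _ (is-just (All.lookup es αγ∈edges))
      εδ = cpt-domain _ _ (is-just (All.lookup es εδ∈edges))
      βγ = cpt-domain _ _ (is-just (All.lookup es βγ∈edges))
      αε = cpt-domain _ _ (is-just (All.lookup es αε∈edges))

      value∈ : ∀ a → lookup W a ∈ₛ dom (lookup V (owner a))
      value∈ α = proj₁ αγ
      value∈ β = proj₁ βγ
      value∈ γ = proj₁ (proj₂ αγ)
      value∈ δ = proj₁ (proj₂ εδ)
      value∈ ε = proj₁ εδ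

      V-injective : ∀ v w → lookup V v ≡ lookup V w → v ≡ w
      V-injective x x _  = refl
      V-injective x y eq = contradiction (sym eq) (proj₂ (proj₂ αε))
      V-injective x z eq = contradiction eq (proj₂ (proj₂ εδ))
      V-injective y x eq = contradiction eq (proj₂ (proj₂ αε))
      V-injective y y _  = refl
      V-injective y z eq = contradiction eq (proj₂ (proj₂ αγ))
      V-injective z x eq = contradiction (sym eq) (proj₂ (proj₂ εδ))
      V-injective z y eq = contradiction (sym eq) (proj₂ (proj₂ αγ))
      V-injective z z _  = refl

      cpt-preserved : ∀ p q {t} → BT.cpt p q ≡ just t →
        cpt (lookup V (proj₁ p) , lookup W (proj₂ p)) (lookup V (proj₁ q) , lookup W (proj₂ q)) ≡ just t
      cpt-preserved (v , a) (w , b) eq with cpt⇒edge (v , a) (w , b) eq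
      ... | refl , inj₁ e = All.lookup es e
      ... | refl , inj₂ e = trans (cpt-sym _ _) (All.lookup es e)

    -- Equality contradicts `forced-irrefl`, and the reverse order turns the realisation into an
    -- occurrence.
    avoids⇒forced≺ : ¬ Occurs (orderedBT _<X_ isSPO) (proj₁ oi) (proj₂ oi) D< →
                     ∀ a b → T (forced oi precedences a b) → a ≺ᴰ b
    avoids⇒forced≺ avoids a b r with compareᴰ a b
    ... | tri< a≺b _ _   = a≺b
    ... | tri≈ _ a≡b _   = contradiction a≡b (forced-irrefl oi precedences r)
    ... | tri> _ _ b≺a   =
      let V , W , α≡ , β≡ , r′ = forced⁻ oi precedences r
          es , ps = realises⁻ oi precedences V W edges r′
      in contradiction (realises⇒occurs V W es ps (subst₂ _≺ᴰ_ (sym β≡) (sym α≡) b≺a)) avoids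

    forced≺⇒avoids : (∀ {a b} → T (forced oi precedences a b) → a ≺ᴰ b) →
                     ¬ Occurs (orderedBT _<X_ isSPO) (proj₁ oi) (proj₂ oi) D<
    forced≺⇒avoids forced≺ h =
      let V , W , es , ps , β≺α = occurs⇒realises h
      in asymᴰ β≺α (forced≺ (forced⁺ oi precedences V W (realises⁺ oi precedences V W edges es ps)))

-- Building blocks of terms and their values

trueT : Term n m safe
trueT = cons nil nil

notT : Term n m safe → Term n m safe
notT e = ite e nil trueT

andT orT : Term n m safe → Term n m safe → Term n m safe
andT d e = ite d e nil
orT d e  = ite d trueT e

allT : (A → Term n m safe) → List A → Term n m safe
allT f []       = trueT
allT f (a ∷ as) = andT (f a) (allT f as)

-- Indexing is a loop along the unary index, which is therefore normal.
dropT : Term n m normal → Term n m safe → Term n m safe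
dropT i e = iter i e (tl (svar zero))

entryT : Term n m safe → Term n m normal → Term n m safe
entryT e i = hd (dropT i e)

-- On numerals `dropT` is truncated subtraction; both differences vanish exactly for equal numbers.
equalT : Fin n → Fin n → Term n m safe
equalT i j = ite (dropT (nvar i) (nvar j)) nil (ite (dropT (nvar j) (nvar i)) nil trueT)

-- Counters run downwards, so consing in front yields the entries in ascending order.
anyT tableT : Term n m normal → Term (suc n) (suc m) safe → Term n m safe
anyT l e   = iter l nil (orT e (svar zero))
tableT l e = iter l nil (cons e (svar zero))

-- Values of subterms enter these lemmas through equations, so that correctness proofs follow the
-- structure of terms.
not-code : u ≡ codeBool b → branch u nil (nil ∙ nil) ≡ codeBool (not b)
not-code {b = false} refl = refl
not-code {b = true}  refl = refl

∧-code : u ≡ codeBool b → v ≡ codeBool c → branch u v nil ≡ codeBool (b ∧ c)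
∧-code {b = false} refl q = refl
∧-code {b = true}  refl q = q

∨-code : u ≡ codeBool b → v ≡ codeBool c → branch u (nil ∙ nil) v ≡ codeBool (b ∨ c)
∨-code {b = false} refl q = q
∨-code {b = true}  refl q = refl

all-code : (f : A → Term n m safe) (g : A → Bool) {ν : Vec Tree n} {σ : Vec Tree m} →
           (∀ a → ⟦ f a ⟧ ν σ ≡ codeBool (g a)) → ∀ as → ⟦ allT f as ⟧ ν σ ≡ codeBool (all g as)
all-code f g h []       = refl
all-code f g h (a ∷ as) = ∧-code (h a) (all-code f g h as)

drop : Tree → Tree → Tree
drop = iterate (λ _ → tail)

drop-nil : ∀ k → drop (codeℕ k) nil ≡ nil
drop-nil zero    = refl
drop-nil (suc k) = drop-nil k

entry-code : ∀ (g : Fin p → Tree) (k : Fin p) → u ≡ codeTable g → v ≡ codeℕ (toℕ k) → head (drop v u) ≡ g k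
entry-code g zero    refl refl = refl
entry-code g (suc k) refl refl = entry-code (g ∘ suc) k refl refl

equal-code : ∀ i j → u ≡ codeℕ i → v ≡ codeℕ j →
             branch (drop u v) nil (branch (drop v u) nil (nil ∙ nil)) ≡ codeBool (i ≡ᵇ j)
equal-code zero    zero    refl refl = refl
equal-code zero    (suc j) refl refl = refl
equal-code (suc i) zero    refl refl rewrite drop-nil i = refl
equal-code (suc i) (suc j) refl refl = equal-code i j refl refl

-- The accumulator remains the code of the state of the fold.
iterate-code : (code : A → Tree) {step : Tree → Tree → Tree} {f : Fin p → A → A} →
               u ≡ codeℕ p → (∀ i a → step (codeℕ (toℕ i)) (code a) ≡ code (f i a)) →
               ∀ {a} → v ≡ code a → iterate step u v ≡ code (foldFin p f a)
iterate-code {p = zero}  code refl h q = q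
iterate-code {p = suc p} code {step} {f} refl h {a} refl =
  iterate-code code refl
    (λ i a → trans (cong (λ k → step (codeℕ k) (code a)) (sym (toℕ-inject₁ i))) (h (inject₁ i) a))
    (trans (cong (λ k → step (codeℕ k) (code a)) (sym (toℕ-fromℕ p))) (h (fromℕ p) a))

any-code : {φ : Tree → Tree → Tree} {f : Fin p → Bool} → u ≡ codeℕ p →
           (∀ i a → φ (codeℕ (toℕ i)) a ≡ codeBool (f i)) →
           iterate (λ t a → branch (φ t a) (nil ∙ nil) a) u nil ≡ codeBool (anyFin f)
any-code l h = iterate-code codeBool l (λ i a → ∨-code (h i (codeBool a)) refl) refl

-- The tail is arbitrary because the induction moves the last entry into it.
foldFin-∷ : (f : Fin p → A) (as : List A) →
            foldFin p (λ i → f i ∷_) as ≡ tabulate f ++ as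
foldFin-∷ {p = zero}  f as = refl
foldFin-∷ {p = suc p} f as = trans (foldFin-∷ (f ∘ inject₁) (f (fromℕ p) ∷ as)) (snoc f)
  where
  snoc : ∀ {p} (f : Fin (suc p) → _) →
         tabulate (f ∘ inject₁) ++ f (fromℕ p) ∷ as ≡ tabulate f ++ as
  snoc {zero}  f = refl
  snoc {suc p} f = cong (f zero ∷_) (snoc (f ∘ suc))

table-code : {φ : Tree → Tree → Tree} {f : Fin p → Tree} → u ≡ codeℕ p →
             (∀ i a → φ (codeℕ (toℕ i)) a ≡ f i) →
             iterate (λ t a → φ t a ∙ a) u nil ≡ codeTable f
table-code {p = p} {f = f} l h =
  trans (iterate-code codeList l (λ i as → cong (_∙ codeList as) (h i (codeList as))) {a = []} refl)
        (cong codeList (trans (foldFin-∷ f []) (++-identityʳ (tabulate f))))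

-- The terms of the algorithm

#XT #DT cptT X<T : Fin n → ∀ {k} → Term n m k
#XT i  = hd (hd (nvar i))
#DT i  = hd (tl (hd (nvar i)))
cptT i = hd (tl (tl (tl (hd (nvar i)))))
X<T i  = tl (nvar i)

-- codeMaybe codeBool sends nothing, just false and just true to the numerals
-- 0, 1 and 2, and codeBool sends false and true to 0 and 1.
matchT : Bool → Term n m safe → Term n m safe
matchT true  e = tl e
matchT false e = ite e (notT (tl e)) nil

match-code : ∀ t {e : Term n m safe} (r : Maybe Bool) {ν σ} → ⟦ e ⟧ ν σ ≡ codeMaybe codeBool r →
             ⟦ matchT t e ⟧ ν σ ≡ codeBool ⌊ ≡-dec _≟ᵇ_ r (just t) ⌋
match-code true  nothing      eq rewrite eq = refl
match-code true  (just true)  eq rewrite eq = refl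
match-code true  (just false) eq rewrite eq = refl
match-code false nothing      eq rewrite eq = refl
match-code false (just true)  eq rewrite eq = refl
match-code false (just false) eq rewrite eq = refl

module _ (i : Fin n) (V : Vec (Fin n) 3) (W : Vec (Fin n) 5) where

  edgeT : Fin 5 × Fin 5 × Bool → Term n m safe
  edgeT (a , b , t) = matchT t
    (entryT (entryT (entryT (entryT (cptT i)
      (nvar (lookup V (owner a)))) (nvar (lookup W a)))
      (nvar (lookup V (owner b)))) (nvar (lookup W b)))

  precedenceT : Fin 3 × Fin 3 → Term n m safe
  precedenceT (v , w) = entryT (entryT (X<T i) (nvar (lookup V v))) (nvar (lookup V w))

  realisesT : List (Fin 3 × Fin 3) → Term n m safe
  realisesT precedences = andT (allT edgeT edges) (allT precedenceT precedences)

-- The loops choose, from outside in, the images of x, y, z, γ, δ, ε; the innermost counter has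
-- index 0, and `i`, `a`, `b` are shifted past all six.
forcedT : List (Fin 3 × Fin 3) → Fin n → Fin n → Fin n → Term n m safe
forcedT precedences i a b =
  anyT (#XT i) (anyT (#XT (1 ↑ʳ i)) (anyT (#XT (2 ↑ʳ i))
    (anyT (#DT (3 ↑ʳ i)) (anyT (#DT (4 ↑ʳ i)) (anyT (#DT (5 ↑ʳ i))
      (realisesT (6 ↑ʳ i)
        (# 5 ∷ # 4 ∷ # 3 ∷ []) ((6 ↑ʳ a) ∷ (6 ↑ʳ b) ∷ # 2 ∷ # 1 ∷ # 0 ∷ []) precedences))))))

relEntryT : Fin m → Fin n → Fin n → Term n m safe
relEntryT r a b = entryT (entryT (svar r) (nvar a)) (nvar b)

identityT : Fin n → Term n m safe
identityT i = tableT (#DT i) (tableT (#DT (1 ↑ʳ i)) (equalT (# 1) (# 0)))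

-- Scopes are arbitrary because constraints are queried at several loop depths. The positions are
-- those of the instance and of the two values.
PairT : Set
PairT = ∀ {n m} → Fin n → Fin n → Fin n → Term n m safe

alwaysT : PairT
alwaysT _ _ _ = trueT

extendT : PairT → Fin n → Fin n → Fin n → Fin m → Term n m safe
extendT c o i j r =
  tableT (#DT o) (tableT (#DT (1 ↑ʳ o))
    (orT (R (# 1) (# 0))
      (andT (c (2 ↑ʳ o) (2 ↑ʳ i) (2 ↑ʳ j))
        (andT (notT (R (2 ↑ʳ j) (2 ↑ʳ i)))
          (andT (R (# 1) (2 ↑ʳ i)) (R (2 ↑ʳ j) (# 0)))))))
  where
  -- The two table loops put their accumulators in front of `r`.
  R = relEntryT (2 ↑ʳ r)

sweepT : PairT → Fin n → Term n m safe → Term n m safe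
sweepT c i e =
  -- The inner loop starts from the accumulator of the outer one, so one relation is threaded
  -- through both.
  iter (#DT i) e (iter (#DT (1 ↑ʳ i)) (svar (# 0)) (extendT c (2 ↑ʳ i) (# 1) (# 0) (# 0)))

linearExtensionT : PairT → Fin n → Term n m safe
linearExtensionT c i = sweepT alwaysT i (sweepT c i (identityT i))

-- The linear extension is recomputed for every pair, which keeps the time polynomial.
violatedT : PairT → Fin n → Term n m safe
violatedT c i =
  anyT (#DT i) (anyT (#DT (1 ↑ʳ i))
    (andT (c (2 ↑ʳ i) (# 1) (# 0))
          (entryT (entryT (linearExtensionT c (2 ↑ʳ i)) (nvar (# 0))) (nvar (# 1)))))

solveT : PairT → Fin n → Term n m safe
solveT c i = ite (violatedT c i) nil (cons nil
  (tableT (#DT i) (tableT (#DT (1 ↑ʳ i))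
    (notT (entryT (entryT (linearExtensionT c (2 ↑ʳ i)) (nvar (# 0))) (nvar (# 1)))))))

-- Correctness of the terms

codeRel : BoolRel p → Tree
codeRel R = codeTable λ a → codeTable λ b → codeBool (R a b)

relEntry-code : (R : BoolRel p) (a b : Fin p) → t ≡ codeRel R → u ≡ codeℕ (toℕ a) → v ≡ codeℕ (toℕ b) →
                head (drop v (head (drop u t))) ≡ codeBool (R a b)
relEntry-code R a b r p q =
  entry-code (λ b → codeBool (R a b)) b (entry-code (λ a → codeTable λ b → codeBool (R a b)) a r p) q

module _ (oi : OrderedInstance) (precedences : List (Fin 3 × Fin 3)) where
  open Instance (proj₁ oi)
  open TotalOrder (proj₂ oi) using (_<?_)

  #X-code : t ≡ codeOrderedInstance oi → head (head t) ≡ codeℕ #X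
  #X-code = cong (head ∘ head)

  #D-code : t ≡ codeOrderedInstance oi → head (tail (head t)) ≡ codeℕ #D
  #D-code = cong (head ∘ tail ∘ head)

  module _ {n m} (ν : Vec Tree n) (σ : Vec Tree m) (i : Fin n)
           (inst : lookup ν i ≡ codeOrderedInstance oi) where

    module _ (V : Vec (Fin n) 3) (W : Vec (Fin n) 5) (V′ : Vec (Fin #X) 3) (W′ : Vec (Fin #D) 5)
             (V≡ : ∀ v → lookup ν (lookup V v) ≡ codeℕ (toℕ (lookup V′ v)))
             (W≡ : ∀ a → lookup ν (lookup W a) ≡ codeℕ (toℕ (lookup W′ a))) where

      edge-code : ∀ e → ⟦ edgeT i V W e ⟧ ν σ ≡ codeBool (edgeHolds oi precedences V′ W′ e)
      edge-code (a , b , t) = match-code t (compatible oi precedences V′ W′ a b)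
        (entry-code (λ b → codeMaybe codeBool (cpt (xa , va) (xb , b))) vb
        (entry-code (λ v → codeTable λ b → codeMaybe codeBool (cpt (xa , va) (v , b))) xb
        (entry-code (λ a → codeTable λ v → codeTable λ b → codeMaybe codeBool (cpt (xa , a) (v , b))) va
        (entry-code (λ u → codeTable λ a → codeTable λ v → codeTable λ b → codeMaybe codeBool (cpt (u , a) (v , b))) xa
          (cong (head ∘ tail ∘ tail ∘ tail ∘ head) inst)
          (V≡ (owner a))) (W≡ a)) (V≡ (owner b))) (W≡ b))
        where
        xa = lookup V′ (owner a)
        xb = lookup V′ (owner b)
        va = lookup W′ a
        vb = lookup W′ b

      precedence-code : ∀ e → ⟦ precedenceT i V W e ⟧ ν σ ≡ codeBool (precedenceHolds oi precedences V′ W′ e)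
      precedence-code (v , w) = trans
        (relEntry-code {p = #X} (λ u v → does (u <? v)) (lookup V′ v) (lookup V′ w)
          (cong tail inst) (V≡ v) (V≡ w))
        -- `codeOrder` tabulates `does`, whereas `precedenceHolds` uses `⌊_⌋`.
        (cong codeBool (sym (isYes≗does _)))

      realises-code : ⟦ realisesT i V W precedences ⟧ ν σ ≡ codeBool (realises oi precedences V′ W′ edges)
      realises-code = ∧-code
        (all-code (edgeT i V W) (edgeHolds oi precedences V′ W′) edge-code edges)
        (all-code (precedenceT i V W) (precedenceHolds oi precedences V′ W′) precedence-code precedences)

  CodesPair : PairT → BoolRel #D → Set
  CodesPair cT c = ∀ {n m} (ν : Vec Tree n) (σ : Vec Tree m) o i j {a b} →
    lookup ν o ≡ codeOrderedInstance oi →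
    lookup ν i ≡ codeℕ (toℕ a) → lookup ν j ≡ codeℕ (toℕ b) →
    ⟦ cT o i j ⟧ ν σ ≡ codeBool (c a b)

  forced-code : CodesPair (forcedT precedences) (forced oi precedences)
  forced-code ν σ o i j {a} {b} inst p q =
    -- The `s` are accumulators of the enclosing loops; the body has the same value for all of them.
    any-code (#X-code inst) λ u s₁ → any-code (#X-code inst) λ v s₂ → any-code (#X-code inst) λ w s₃ →
    any-code (#D-code inst) λ c s₄ → any-code (#D-code inst) λ d s₅ → any-code (#D-code inst) λ e s₆ →
    realises-code
      (codeℕ (toℕ e) ∷ codeℕ (toℕ d) ∷ codeℕ (toℕ c) ∷ codeℕ (toℕ w) ∷ codeℕ (toℕ v) ∷ codeℕ (toℕ u) ∷ ν)
      (s₆ ∷ s₅ ∷ s₄ ∷ s₃ ∷ s₂ ∷ s₁ ∷ σ)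
      (6 ↑ʳ o) inst
      (# 5 ∷ # 4 ∷ # 3 ∷ []) ((6 ↑ʳ i) ∷ (6 ↑ʳ j) ∷ # 2 ∷ # 1 ∷ # 0 ∷ [])
      (u ∷ v ∷ w ∷ []) (a ∷ b ∷ c ∷ d ∷ e ∷ [])
      (λ { x → refl ; y → refl ; z → refl })
      (λ { α → p ; β → q ; γ → refl ; δ → refl ; ε → refl })

  module _ (cT : PairT) (c : BoolRel #D) (c-code : CodesPair cT c) where

    extend-code : ∀ {n m} (ν : Vec Tree n) (σ : Vec Tree m) o i j r {a b R} →
      lookup ν o ≡ codeOrderedInstance oi →
      lookup ν i ≡ codeℕ (toℕ a) → lookup ν j ≡ codeℕ (toℕ b) →
      lookup σ r ≡ codeRel R →
      ⟦ extendT cT o i j r ⟧ ν σ ≡ codeRel (extend c a b R)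
    extend-code ν σ o i j r {a} {b} {R} inst p q s =
      table-code (#D-code inst) λ d s₁ → table-code (#D-code inst) λ e s₂ →
      ∨-code (relEntry-code R d e s refl refl)
        (∧-code (c-code (codeℕ (toℕ e) ∷ codeℕ (toℕ d) ∷ ν) (s₂ ∷ s₁ ∷ σ) (2 ↑ʳ o) (2 ↑ʳ i) (2 ↑ʳ j) inst p q)
          (∧-code (not-code (relEntry-code R b a s q p))
            (∧-code (relEntry-code R d a s refl p) (relEntry-code R b e s q refl))))

    sweep-code : ∀ {n m} (ν : Vec Tree n) (σ : Vec Tree m) o e {R} →
      lookup ν o ≡ codeOrderedInstance oi → ⟦ e ⟧ ν σ ≡ codeRel R →
      ⟦ sweepT cT o e ⟧ ν σ ≡ codeRel (sweep c R)
    sweep-code ν σ o e inst r =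
      iterate-code codeRel (#D-code inst) (λ a R →
        iterate-code codeRel (#D-code inst) (λ b R′ →
          extend-code (codeℕ (toℕ b) ∷ codeℕ (toℕ a) ∷ ν) (codeRel R′ ∷ codeRel R ∷ σ)
            (2 ↑ʳ o) (# 1) (# 0) (# 0) inst refl refl refl) refl) r

  identity-code : ∀ {n m} (ν : Vec Tree n) (σ : Vec Tree m) o →
    lookup ν o ≡ codeOrderedInstance oi → ⟦ identityT o ⟧ ν σ ≡ codeRel (identity {#D})
  identity-code ν σ o inst =
    table-code (#D-code inst) λ a _ → table-code (#D-code inst) λ b _ →
    equal-code (toℕ a) (toℕ b) refl refl

  module _ (cT : PairT) (c : BoolRel #D) (c-code : CodesPair cT c) where

    linearExtension-code : ∀ {n m} (ν : Vec Tree n) (σ : Vec Tree m) o →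
      lookup ν o ≡ codeOrderedInstance oi →
      ⟦ linearExtensionT cT o ⟧ ν σ ≡ codeRel (linearExtension c)
    linearExtension-code ν σ o inst =
      sweep-code alwaysT always (λ _ _ _ _ _ _ _ _ → refl) ν σ o (sweepT cT o (identityT o)) inst
        (sweep-code cT c c-code ν σ o (identityT o) inst (identity-code ν σ o inst))

    violated-code : ∀ {n m} (ν : Vec Tree n) (σ : Vec Tree m) o →
      lookup ν o ≡ codeOrderedInstance oi →
      ⟦ violatedT cT o ⟧ ν σ ≡ codeBool (violated c)
    violated-code ν σ o inst =
      any-code (#D-code inst) λ a s₁ → any-code (#D-code inst) λ b s₂ →
      let ν′ = codeℕ (toℕ b) ∷ codeℕ (toℕ a) ∷ ν ; σ′ = s₂ ∷ s₁ ∷ σ in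
      ∧-code (c-code ν′ σ′ (2 ↑ʳ o) (# 1) (# 0) inst refl refl)
             (relEntry-code (linearExtension c) b a (linearExtension-code ν′ σ′ (2 ↑ʳ o) inst) refl refl)

    solve-code : ∀ {n m} (ν : Vec Tree n) (σ : Vec Tree m) o →
      lookup ν o ≡ codeOrderedInstance oi →
      ⟦ solveT cT o ⟧ ν σ ≡
      branch (codeBool (violated c)) nil (nil ∙ codeRel (λ a b → not (linearExtension c b a)))
    solve-code ν σ o inst = cong₂ (λ u v → branch u nil (nil ∙ v)) (violated-code ν σ o inst)
      (table-code (#D-code inst) λ a s₁ → table-code (#D-code inst) λ b s₂ →
        not-code (relEntry-code (linearExtension c) b a
          (linearExtension-code (codeℕ (toℕ b) ∷ codeℕ (toℕ a) ∷ ν) (s₂ ∷ s₁ ∷ σ) (2 ↑ʳ o) inst) refl refl))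

-- The solution and its code

-- Any two decisions of one proposition have the same Boolean, and that of `T? b` is `b`.
codeOrder-strict : ∀ {n} (c : BoolRel n) → codeOrder (strict c) ≡ codeRel (λ a b → not (linearExtension c b a))
codeOrder-strict c =
  cong codeList (tabulate-cong λ a → cong codeList (tabulate-cong λ b →
    cong codeBool (does-≡ (a <? b) (T? _))))
  where open TotalOrder (strict c)

solution : ∀ {n} → BoolRel n → Maybe (TotalOrder n)
solution c = if violated c then nothing else just (strict c)

codeSolution : ∀ {n} (c : BoolRel n) →
  branch (codeBool (violated c)) nil (nil ∙ codeRel (λ a b → not (linearExtension c b a))) ≡
  codeMaybe codeOrder (solution c)
codeSolution c with violated c
... | true  = refl
... | false = cong (nil ∙_) (sym (codeOrder-strict c))

module _ (_<X_ : Rel (Fin 3) 0ℓ) (isSPO : IsStrictPartialOrder _≡_ _<X_)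
         (precedences : List (Fin 3 × Fin 3))
         (complete : ∀ v w → v <X w → (v , w) ∈ precedences)
         (sound : All (λ (v , w) → v <X w) precedences) where

  orderedBT-solvable : PolyTimeSolvable OrderedInstance DomainOrdering
    codeOrderedInstance codeDomainOrdering (Avoids (orderedBT _<X_ isSPO))
  orderedBT-solvable = term-polyTimeSolvable (solveT (forcedT precedences) zero) λ oi →
    let c = forced oi precedences in
    solution c , avoids oi ,
    trans (solve-code oi precedences (forcedT precedences) c (forced-code oi precedences)
             (codeOrderedInstance oi ∷ []) [] zero refl)
          (codeSolution c)
    where
    avoids : ∀ oi → Avoids (orderedBT _<X_ isSPO) oi (solution (forced oi precedences))
    avoids oi with violated (forced oi precedences) in eq
    ... | true  = λ (D< , avoids) →
      violated⇒no-extension (forced oi precedences) (subst T (sym eq) _) D<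
        (avoids⇒forced≺ _<X_ isSPO precedences complete sound oi D< avoids)
    ... | false = lift (forced≺⇒avoids _<X_ isSPO precedences complete sound oi (strict (forced oi precedences))
      (¬violated⇒strict-extends (forced oi precedences) (subst T eq)))

theorem4p3 : (P : Pattern) → P ≡ BTI ⊎ P ≡ BTX →
    PolyTimeSolvable OrderedInstance DomainOrdering
    codeOrderedInstance codeDomainOrdering (Avoids P)
theorem4p3 _ (inj₁ refl) = orderedBT-solvable BT._<BTI_ BT.<BTI-isStrictPartialOrder
  ((x , z) ∷ [])
  (λ { _ _ BT.x<z → here refl })
  (BT.x<z ∷ [])
theorem4p3 _ (inj₂ refl) = orderedBT-solvable BT._<BTX_ BT.<BTX-isStrictPartialOrder
  ((y , x) ∷ (y , z) ∷ [])
  (λ { _ _ BT.y<x → here refl ; _ _ BT.y<z → there (here refl) })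
  (BT.y<x ∷ BT.y<z ∷ [])
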